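{- If $\mathbf V$ is a model (in intuitionistic first-order logic) of the core axioms of material set theory together with material collection, then the category $\mathbb{S}\mathrm{et}(\mathbf V)$ of sets and functions in $\mathbf V$ satisfies structural collection, i.e. the axiom schemas of collection of sets and collection of functions, and the axiom of collection of equalities.
   Context: **Material set theory.** One-sorted intuitionistic first-order logic with one binary relation $\in$. Formulas in axiom schemas may contain further free variables (parameters), universally quantified outside each instance. A $\Delta_0$-formula is one all of whose quantifiers are bounded, $\exists x\in a$ or $\forall x\in a$. Ordered pairs are $(x,y)=\{\{x\},\{x,y\}\}$; functions are sets of ordered pairs as usual. Core axioms: *Extensionality*; *Empty set*; *Pairing* ($\{x,y\}$ exists); *Union* ($\{z\mid \exists y\in x,\ z\in y\}$ exists); *$\Delta_0$-Separation* (for $\Delta_0$ $\varphi(x)$ and any $a$, $\{x\in a\mid\varphi(x)\}$ exists); *Limited $\Delta_0$-replacement* (for $\Delta_0$ $\varphi(x,y)$: for all $a,b$, if for every $x\in a$ there is a unique $y$ with $\varphi(x,y)$, and moreover $z\subseteq b$ for all $z\in y$, then $\{y\mid\exists x\in a,\ \varphi(x,y)\}$ exists). *Material collection*: for any formula $\varphi(x,y)$ and any $a$, if for all $x\in a$ there is a $y$ with $\varphi(x,y)$, then there is a $b$ such that for all $x\in a$ there is $y\in b$ with $\varphi(x,y)$, and for all $y\in b$ there is $x\in a$ with $\varphi(x,y)$. **Language of categories.** Statements about a category are formulated in a dependently typed intuitionistic first-order language: a type of objects, and for objects $X,Y$ a type $X\to Y$ of arrows; identities, composition and a distinguished terminal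 object $1$; the only atomic formulas are equalities of parallel arrows (no equality of objects); connectives, and quantifiers over objects and over arrows (one may not quantify over an object variable occurring in the type of a free arrow variable). Formulas in schemas may contain parameters. **Structural collection** for a category $\mathbf{Set}$ with finite limits. An element $x$ of $X$ means an arrow $x\colon 1\to X$; for $A\in\mathbf{Set}/V$ and $v\colon 1\to V$, $v^*A$ is the pullback of $A\to V$ along $v$, and similarly for arrows of slices and for pullback along general maps. *Collection of sets*: for any formula $\varphi(u,X)$ with $u$ an element variable of $U$ and $X$ an object variable: if for every element $u$ of $U$ there is an $X$ with $\varphi(u,X)$, then there are a regular epi $p\colon V\to U$ and an object $A$ of $\mathbf{Set}/V$ such that $\varphi(pv,v^*A)$ for every element $v$ of $V$. *Collection of functions*: for any formula $\varphi(u,X,Y,f)$ with $u$ an element variable of $U$, $X,Y$ object variables and $f\colon X\to Y$: for any $A,B$ in $\mathbf{Set}/U$, if for every element $u$ of $U$ there is $f\colon u^*A\to u^*B$ with $\varphi(u,u^*A,u^*B,f)$, then there are a regular epi $p\colon V\to U$ and an arrow $g\colon p^*A\to p^*B$ in $\mathbf{Set}/V$ such that $\varphi(pv,(pv)^*A,(pv)^*B,v^*g)$ for every element $v$ of $V$. *Collection of equalities*: for any $U$, any $A,B$ in $\mathbf{Set}/U$ and $f,g\colon A\to B$ in $\mathbf{Set}/U$, if $u^*f=u^*g$ for every element $u$ of $U$, then there is a regular epi $p\colon V\to U$ with $p^*f=p^*g$. -}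

module Defs where

open import Level using (Level; suc)
open import Data.Nat.Base using (ℕ; _+_) renaming (suc to 1+)
open import Data.Fin.Base using (Fin; zero) renaming (suc to fsuc)
open import Data.Fin.Patterns
open import Data.Vec.Base using (Vec; []; _∷_; lookup)
open import Data.Product using (Σ; ∃; ∃!; _×_; _,_; proj₁; proj₂; Σ-syntax; ∃-syntax)
open import Data.Sum.Base as Sum using (_⊎_; inj₁; inj₂; [_,_]′)
open import Data.Unit.Polymorphic using (⊤; tt)
open import Data.Empty.Polymorphic using (⊥)
open import Function.Base using (_∋_)
open import Function.Bundles using (_⇔_; mk⇔; Equivalence)
open import Relation.Nullary.Negation.Core using (¬_)
open import Relation.Binary.Core using (Rel)
open import Relation.Binary.Definitions using (_Respects₂_)
open import Relation.Binary.Structures using (IsEquivalence)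

open Equivalence using (to; from)

private
  variable
    ℓ : Level
    n : ℕ

infix  7 _∈′_ _≈′_
infixr 6 _∧′_
infixr 5 _∨′_
infixr 4 _⇒′_

-- Formulas with n free variables (de Bruijn indices).
data Formula (n : ℕ) : Set where
  _∈′_ _≈′_      : Fin n → Fin n → Formula n
  ⊤′ ⊥′          : Formula n
  _∧′_ _∨′_ _⇒′_ : Formula n → Formula n → Formula n
  ∀′ ∃′          : Formula (1+ n) → Formula n

∀∈′ ∃∈′ : Fin n → Formula (1+ n) → Formula n
∀∈′ a φ = ∀′ (zero ∈′ fsuc a ⇒′ φ)
∃∈′ a φ = ∃′ (zero ∈′ fsuc a ∧′ φ)

data Δ₀ : Formula n → Set where
  ∈₀  : {i j : Fin n} → Δ₀ (i ∈′ j)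
  ≈₀  : {i j : Fin n} → Δ₀ (i ≈′ j)
  ⊤₀  : Δ₀ (Formula n ∋ ⊤′)
  ⊥₀  : Δ₀ (Formula n ∋ ⊥′)
  ∧₀  : {φ ψ : Formula n} → Δ₀ φ → Δ₀ ψ → Δ₀ (φ ∧′ ψ)
  ∨₀  : {φ ψ : Formula n} → Δ₀ φ → Δ₀ ψ → Δ₀ (φ ∨′ ψ)
  ⇒₀  : {φ ψ : Formula n} → Δ₀ φ → Δ₀ ψ → Δ₀ (φ ⇒′ ψ)
  ∀∈₀ : {a : Fin n} {φ : Formula (1+ n)} → Δ₀ φ → Δ₀ (∀∈′ a φ)
  ∃∈₀ : {a : Fin n} {φ : Formula (1+ n)} → Δ₀ φ → Δ₀ (∃∈′ a φ)

-- Equality of the theory is interpreted by an arbitrary congruence, since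
-- extensionality rarely holds for Agda's _≡_.
record ∈-Structure (ℓ : Level) : Set (suc ℓ) where
  infix 4 _∈_ _≈_ _⊆_
  field
    Carrier       : Set ℓ
    _≈_           : Rel Carrier ℓ
    _∈_           : Rel Carrier ℓ
    isEquivalence : IsEquivalence _≈_
    ∈-resp-≈      : _∈_ Respects₂ _≈_

  _⊆_ : Rel Carrier ℓ
  x ⊆ y = ∀ z → z ∈ x → z ∈ y

  -- Intuitionistic (Tarskian) satisfaction.
  ⟦_⟧ : Formula n → Vec Carrier n → Set ℓ
  ⟦ i ∈′ j ⟧ ρ = lookup ρ i ∈ lookup ρ j
  ⟦ i ≈′ j ⟧ ρ = lookup ρ i ≈ lookup ρ j
  ⟦ ⊤′ ⟧     ρ = ⊤
  ⟦ ⊥′ ⟧     ρ = ⊥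
  ⟦ φ ∧′ ψ ⟧ ρ = ⟦ φ ⟧ ρ × ⟦ ψ ⟧ ρ
  ⟦ φ ∨′ ψ ⟧ ρ = ⟦ φ ⟧ ρ ⊎ ⟦ ψ ⟧ ρ
  ⟦ φ ⇒′ ψ ⟧ ρ = ⟦ φ ⟧ ρ → ⟦ ψ ⟧ ρ
  ⟦ ∀′ φ ⟧   ρ = ∀ x → ⟦ φ ⟧ (x ∷ ρ)
  ⟦ ∃′ φ ⟧   ρ = ∃[ x ] ⟦ φ ⟧ (x ∷ ρ)

-- In the schemas, ρ is the list of parameters.
record CoreAxioms (M : ∈-Structure ℓ) : Set ℓ where
  open ∈-Structure M
  field
    extensionality : ∀ x y → (∀ z → z ∈ x ⇔ z ∈ y) → x ≈ y
    empty          : ∃[ e ] ∀ z → ¬ (z ∈ e)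
    pairing        : ∀ x y → ∃[ p ] ∀ z → z ∈ p ⇔ (z ≈ x ⊎ z ≈ y)
    union          : ∀ x → ∃[ u ] ∀ z → z ∈ u ⇔ (∃[ y ] y ∈ x × z ∈ y)
    Δ₀-separation  :
      ∀ {n} (φ : Formula (1+ n)) → Δ₀ φ → (ρ : Vec Carrier n) →
      ∀ a → ∃[ s ] ∀ x → x ∈ s ⇔ (x ∈ a × ⟦ φ ⟧ (x ∷ ρ))
    limited-Δ₀-replacement :
      ∀ {n} (φ : Formula (2 + n)) → Δ₀ φ → (ρ : Vec Carrier n) →
      ∀ a b →
      (∀ x → x ∈ a → ∃! _≈_ (λ y → ⟦ φ ⟧ (x ∷ y ∷ ρ))) →
      (∀ x → x ∈ a → ∀ y → ⟦ φ ⟧ (x ∷ y ∷ ρ) → ∀ z → z ∈ y → z ⊆ b) →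
      ∃[ s ] ∀ y → y ∈ s ⇔ (∃[ x ] x ∈ a × ⟦ φ ⟧ (x ∷ y ∷ ρ))

MaterialCollection : ∈-Structure ℓ → Set ℓ
MaterialCollection M =
  ∀ {n} (φ : Formula (2 + n)) (ρ : Vec Carrier n) (a : Carrier) →
  (∀ x → x ∈ a → ∃[ y ] ⟦ φ ⟧ (x ∷ y ∷ ρ)) →
  ∃[ b ] (∀ x → x ∈ a → ∃[ y ] y ∈ b × ⟦ φ ⟧ (x ∷ y ∷ ρ))
       × (∀ y → y ∈ b → ∃[ x ] x ∈ a × ⟦ φ ⟧ (x ∷ y ∷ ρ))
  where open ∈-Structure M

record Category (ℓ : Level) : Set (suc ℓ) where
  infix  4 _≈_ _⇒_
  infixr 9 _∘_
  field
    Obj           : Set ℓ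
    _⇒_           : Rel Obj ℓ
    _≈_           : ∀ {X Y} → Rel (X ⇒ Y) ℓ
    id            : ∀ {X} → X ⇒ X
    _∘_           : ∀ {X Y Z} → Y ⇒ Z → X ⇒ Y → X ⇒ Z
    isEquivalence : ∀ {X Y} → IsEquivalence (_≈_ {X} {Y})
    identityˡ     : ∀ {X Y} {f : X ⇒ Y} → id ∘ f ≈ f
    identityʳ     : ∀ {X Y} {f : X ⇒ Y} → f ∘ id ≈ f
    assoc         : ∀ {W X Y Z} {f : W ⇒ X} {g : X ⇒ Y} {h : Y ⇒ Z} →
                    (h ∘ g) ∘ f ≈ h ∘ (g ∘ f)
    ∘-resp-≈      : ∀ {X Y Z} {g g′ : Y ⇒ Z} {f f′ : X ⇒ Y} →
                    g ≈ g′ → f ≈ f′ → g ∘ f ≈ g′ ∘ f′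

  module Eq {X Y : Obj} = IsEquivalence (isEquivalence {X} {Y})

module _ (C : Category ℓ) where
  open Category C

  record Terminal : Set ℓ where
    field
      𝟏        : Obj
      !        : ∀ {X} → X ⇒ 𝟏
      !-unique : ∀ {X} (f : X ⇒ 𝟏) → f ≈ !

  record Pullback {X Y Z : Obj} (f : X ⇒ Z) (g : Y ⇒ Z) : Set ℓ where
    field
      P            : Obj
      p₁           : P ⇒ X
      p₂           : P ⇒ Y
      commute      : f ∘ p₁ ≈ g ∘ p₂
      universal    : ∀ {W} (h : W ⇒ X) (k : W ⇒ Y) → f ∘ h ≈ g ∘ k → W ⇒ P
      p₁∘universal : ∀ {W} {h : W ⇒ X} {k : W ⇒ Y} {eq : f ∘ h ≈ g ∘ k} →
                     p₁ ∘ universal h k eq ≈ h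
      p₂∘universal : ∀ {W} {h : W ⇒ X} {k : W ⇒ Y} {eq : f ∘ h ≈ g ∘ k} →
                     p₂ ∘ universal h k eq ≈ k
      unique       : ∀ {W} {h : W ⇒ X} {k : W ⇒ Y} {eq : f ∘ h ≈ g ∘ k}
                     (i : W ⇒ P) → p₁ ∘ i ≈ h → p₂ ∘ i ≈ k →
                     i ≈ universal h k eq

  record FiniteLimits : Set ℓ where
    field
      terminal : Terminal
      pullback : ∀ {X Y Z} (f : X ⇒ Z) (g : Y ⇒ Z) → Pullback f g

  record IsCoequalizer {X Y Z : Obj} (f g : X ⇒ Y) (q : Y ⇒ Z) : Set ℓ where
    field
      equalizes  : q ∘ f ≈ q ∘ g
      coequalize : ∀ {W} (h : Y ⇒ W) → h ∘ f ≈ h ∘ g → Z ⇒ W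
      factors    : ∀ {W} {h : Y ⇒ W} {eq : h ∘ f ≈ h ∘ g} →
                   coequalize h eq ∘ q ≈ h
      unique     : ∀ {W} {h : Y ⇒ W} {eq : h ∘ f ≈ h ∘ g} (k : Z ⇒ W) →
                   k ∘ q ≈ h → k ≈ coequalize h eq

  IsRegularEpi : {Y Z : Obj} → Y ⇒ Z → Set ℓ
  IsRegularEpi {Y} q = ∃[ X ] Σ[ f ∈ X ⇒ Y ] Σ[ g ∈ X ⇒ Y ] IsCoequalizer f g q

  record Slice (U : Obj) : Set ℓ where
    constructor slice
    field
      {dom} : Obj
      map   : dom ⇒ U

  record _⇒/_ {U : Obj} (A B : Slice U) : Set ℓ where
    field
      arr      : Slice.dom A ⇒ Slice.dom B
      triangle : Slice.map B ∘ arr ≈ Slice.map A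

infixl 5 _▷Ob _▷_⇒_

-- A context declares object variables and arrow variables.  An arrow
-- variable is typed over the objects declared before it, which is what
-- prevents quantification over an object variable occurring in the type of
-- a free arrow variable.
--
-- Weakening of object terms is by constructors, and the constant 1 lives
-- in the empty context, so that every object term has exactly one
-- representation in each context.
data Ctx : Set
data Ob : Ctx → Set

data Ctx where
  ∅     : Ctx
  _▷Ob  : Ctx → Ctx
  _▷_⇒_ : (Γ : Ctx) → Ob Γ → Ob Γ → Ctx

data Ob where
  one : Ob ∅
  new : ∀ {Γ} → Ob (Γ ▷Ob)
  wkₒ : ∀ {Γ} → Ob Γ → Ob (Γ ▷Ob)
  wkₐ : ∀ {Γ X Y} → Ob Γ → Ob (Γ ▷ X ⇒ Y)

𝟙 : ∀ Γ → Ob Γ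
𝟙 ∅           = one
𝟙 (Γ ▷Ob)     = wkₒ (𝟙 Γ)
𝟙 (Γ ▷ X ⇒ Y) = wkₐ (𝟙 Γ)

data ArrVar : (Γ : Ctx) → Ob Γ → Ob Γ → Set where
  new : ∀ {Γ X Y} → ArrVar (Γ ▷ X ⇒ Y) (wkₐ X) (wkₐ Y)
  wkₒ : ∀ {Γ X Y} → ArrVar Γ X Y → ArrVar (Γ ▷Ob) (wkₒ X) (wkₒ Y)
  wkₐ : ∀ {Γ X Y X′ Y′} → ArrVar Γ X Y →
        ArrVar (Γ ▷ X′ ⇒ Y′) (wkₐ X) (wkₐ Y)

data Arr (Γ : Ctx) : Ob Γ → Ob Γ → Set where
  var  : ∀ {X Y} → ArrVar Γ X Y → Arr Γ X Y
  id′  : ∀ {X} → Arr Γ X X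
  _∘′_ : ∀ {X Y Z} → Arr Γ Y Z → Arr Γ X Y → Arr Γ X Z
  !′   : ∀ {X} → Arr Γ X (𝟙 Γ)

data CatFormula (Γ : Ctx) : Set where
  _≈′_           : ∀ {X Y} → Arr Γ X Y → Arr Γ X Y → CatFormula Γ
  ⊤′ ⊥′          : CatFormula Γ
  _∧′_ _∨′_ _⇒′_ : CatFormula Γ → CatFormula Γ → CatFormula Γ
  ∀Ob ∃Ob        : CatFormula (Γ ▷Ob) → CatFormula Γ
  ∀Arr ∃Arr      : (X Y : Ob Γ) → CatFormula (Γ ▷ X ⇒ Y) → CatFormula Γ

module Satisfaction (C : Category ℓ) (T : Terminal C) where
  open Category C
  open Terminal T

  Env   : Ctx → Set ℓ
  ⟦_⟧ₒ  : ∀ {Γ} → Ob Γ → Env Γ → Obj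

  Env ∅           = ⊤
  Env (Γ ▷Ob)     = Env Γ × Obj
  Env (Γ ▷ X ⇒ Y) = Σ[ γ ∈ Env Γ ] ⟦ X ⟧ₒ γ ⇒ ⟦ Y ⟧ₒ γ

  ⟦ one ⟧ₒ   _       = 𝟏
  ⟦ new ⟧ₒ   (_ , A) = A
  ⟦ wkₒ X ⟧ₒ (γ , _) = ⟦ X ⟧ₒ γ
  ⟦ wkₐ X ⟧ₒ (γ , _) = ⟦ X ⟧ₒ γ

  -- ⟦ 𝟙 Γ ⟧ₒ γ is 𝟏, but for variable Γ only by induction.
  fromElement : ∀ {Γ} (γ : Env Γ) {X} → 𝟏 ⇒ X → ⟦ 𝟙 Γ ⟧ₒ γ ⇒ X
  fromElement {∅}         _       x = x
  fromElement {_ ▷Ob}     (γ , _) x = fromElement γ x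
  fromElement {_ ▷ _ ⇒ _} (γ , _) x = fromElement γ x

  ⟦!⟧ : ∀ {Γ} (γ : Env Γ) {X} → X ⇒ ⟦ 𝟙 Γ ⟧ₒ γ
  ⟦!⟧ {∅}         _       = !
  ⟦!⟧ {_ ▷Ob}     (γ , _) = ⟦!⟧ γ
  ⟦!⟧ {_ ▷ _ ⇒ _} (γ , _) = ⟦!⟧ γ

  ⟦_⟧ᵥ : ∀ {Γ X Y} → ArrVar Γ X Y → (γ : Env Γ) → ⟦ X ⟧ₒ γ ⇒ ⟦ Y ⟧ₒ γ
  ⟦ new ⟧ᵥ   (_ , f) = f
  ⟦ wkₒ x ⟧ᵥ (γ , _) = ⟦ x ⟧ᵥ γ
  ⟦ wkₐ x ⟧ᵥ (γ , _) = ⟦ x ⟧ᵥ γ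

  ⟦_⟧ₐ : ∀ {Γ X Y} → Arr Γ X Y → (γ : Env Γ) → ⟦ X ⟧ₒ γ ⇒ ⟦ Y ⟧ₒ γ
  ⟦ var x ⟧ₐ  γ = ⟦ x ⟧ᵥ γ
  ⟦ id′ ⟧ₐ    γ = id
  ⟦ f ∘′ g ⟧ₐ γ = ⟦ f ⟧ₐ γ ∘ ⟦ g ⟧ₐ γ
  ⟦ !′ ⟧ₐ     γ = ⟦!⟧ γ

  ⟦_⟧ : ∀ {Γ} → CatFormula Γ → Env Γ → Set ℓ
  ⟦ f ≈′ g ⟧     γ = ⟦ f ⟧ₐ γ ≈ ⟦ g ⟧ₐ γ
  ⟦ ⊤′ ⟧         γ = ⊤
  ⟦ ⊥′ ⟧         γ = ⊥
  ⟦ φ ∧′ ψ ⟧     γ = ⟦ φ ⟧ γ × ⟦ ψ ⟧ γ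
  ⟦ φ ∨′ ψ ⟧     γ = ⟦ φ ⟧ γ ⊎ ⟦ ψ ⟧ γ
  ⟦ φ ⇒′ ψ ⟧     γ = ⟦ φ ⟧ γ → ⟦ ψ ⟧ γ
  ⟦ ∀Ob φ ⟧      γ = ∀ A → ⟦ φ ⟧ (γ , A)
  ⟦ ∃Ob φ ⟧      γ = ∃[ A ] ⟦ φ ⟧ (γ , A)
  ⟦ ∀Arr X Y φ ⟧ γ = ∀ f → ⟦ φ ⟧ (γ , f)
  ⟦ ∃Arr X Y φ ⟧ γ = ∃[ f ] ⟦ φ ⟧ (γ , f)

module PullbackFunctor (C : Category ℓ) (L : FiniteLimits C) where
  open Category C
  open FiniteLimits L
  open Slice
  open _⇒/_

  private
    module PB {X Y Z : Obj} (f : X ⇒ Z) (g : Y ⇒ Z) = Pullback (pullback f g)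

  infixr 8 _^*_ _^*ₐ_

  _^*_ : ∀ {U V} → V ⇒ U → Slice C U → Slice C V
  p ^* A = slice (PB.p₂ (map A) p)

  _^*ₐ_ : ∀ {U V} (p : V ⇒ U) {A B : Slice C U} →
          _⇒/_ C A B → _⇒/_ C (p ^* A) (p ^* B)
  _^*ₐ_ p {A} {B} h = record
    { arr      = PB.universal (map B) p (arr h ∘ PB.p₁ (map A) p) (PB.p₂ (map A) p)
        (Eq.trans (Eq.sym assoc)
        (Eq.trans (∘-resp-≈ (triangle h) Eq.refl) (PB.commute (map A) p)))
    ; triangle = PB.p₂∘universal (map B) p
    }

  -- The canonical comparison maps between (p ∘ v)^* A and v^* p^* A.
  module _ {U V W : Obj} (p : V ⇒ U) (v : W ⇒ V) (A : Slice C U) where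

    split : dom ((p ∘ v) ^* A) ⇒ dom (v ^* p ^* A)
    split = PB.universal _ v
      (PB.universal (map A) p (PB.p₁ (map A) (p ∘ v)) (v ∘ PB.p₂ (map A) (p ∘ v))
        (Eq.trans (PB.commute (map A) (p ∘ v)) assoc))
      (PB.p₂ (map A) (p ∘ v))
      (PB.p₂∘universal (map A) p)

    merge : dom (v ^* p ^* A) ⇒ dom ((p ∘ v) ^* A)
    merge = PB.universal (map A) (p ∘ v)
      (PB.p₁ (map A) p ∘ PB.p₁ (map (p ^* A)) v)
      (PB.p₂ (map (p ^* A)) v)
      (Eq.trans (Eq.sym assoc)
      (Eq.trans (∘-resp-≈ (PB.commute (map A) p) Eq.refl)
      (Eq.trans assoc
      (Eq.trans (∘-resp-≈ Eq.refl (PB.commute (map (p ^* A)) v))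
                (Eq.sym assoc)))))

  -- v^* g, transported along the canonical isomorphisms to the fibres
  -- over p ∘ v.
  fibre : ∀ {U V W} (p : V ⇒ U) (A B : Slice C U) →
          _⇒/_ C (p ^* A) (p ^* B) → (v : W ⇒ V) →
          dom ((p ∘ v) ^* A) ⇒ dom ((p ∘ v) ^* B)
  fibre p A B g v = merge p v B ∘ arr (v ^*ₐ g) ∘ split p v A

record StructuralCollection (C : Category ℓ) (L : FiniteLimits C) : Set ℓ where
  open Category C
  open FiniteLimits L
  open Terminal terminal
  open Satisfaction C terminal
  open PullbackFunctor C L
  open Slice using (dom)
  open _⇒/_ using (arr)

  -- In the schemas, γ is the list of parameters; U is one of the objects
  -- it declares (or 1), so that the other parameters may refer to U.
  field
    collection-of-sets :
      ∀ {Γ} (γ : Env Γ) (U : Ob Γ) (φ : CatFormula (Γ ▷ 𝟙 Γ ⇒ U ▷Ob)) →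
      let U₀ = ⟦ U ⟧ₒ γ
          φ[_,_] : 𝟏 ⇒ U₀ → Obj → Set ℓ
          φ[ u , X ] = ⟦ φ ⟧ ((γ , fromElement γ u) , X)
      in
      (∀ (u : 𝟏 ⇒ U₀) → ∃[ X ] φ[ u , X ]) →
      ∃[ V ] Σ[ p ∈ V ⇒ U₀ ] IsRegularEpi C p ×
      (Σ[ A ∈ Slice C V ] ∀ (v : 𝟏 ⇒ V) → φ[ p ∘ v , dom (v ^* A) ])

    collection-of-functions :
      ∀ {Γ} (γ : Env Γ) (U : Ob Γ)
        (φ : CatFormula (Γ ▷ 𝟙 Γ ⇒ U ▷Ob ▷Ob ▷ wkₒ new ⇒ new)) →
      let U₀ = ⟦ U ⟧ₒ γ
          φ[_,_,_,_] : 𝟏 ⇒ U₀ → (X Y : Obj) → X ⇒ Y → Set ℓ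
          φ[ u , X , Y , f ] = ⟦ φ ⟧ ((((γ , fromElement γ u) , X) , Y) , f)
      in
      ∀ (A B : Slice C U₀) →
      (∀ (u : 𝟏 ⇒ U₀) → Σ[ f ∈ dom (u ^* A) ⇒ dom (u ^* B) ]
        φ[ u , dom (u ^* A) , dom (u ^* B) , f ]) →
      ∃[ V ] Σ[ p ∈ V ⇒ U₀ ] IsRegularEpi C p ×
      (Σ[ g ∈ _⇒/_ C (p ^* A) (p ^* B) ] ∀ (v : 𝟏 ⇒ V) →
        φ[ p ∘ v , dom ((p ∘ v) ^* A) , dom ((p ∘ v) ^* B) , fibre p A B g v ])

    collection-of-equalities :
      ∀ U (A B : Slice C U) (f g : _⇒/_ C A B) →
      (∀ (u : 𝟏 ⇒ U) → arr (u ^*ₐ f) ≈ arr (u ^*ₐ g)) →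
      ∃[ V ] Σ[ p ∈ V ⇒ U ] IsRegularEpi C p ×
      arr (p ^*ₐ f) ≈ arr (p ^*ₐ g)

-- z = {x , y}
pair′ : (z x y : Fin n) → Formula n
pair′ z x y = x ∈′ z ∧′ y ∈′ z ∧′ ∀∈′ z (0F ≈′ fsuc x ∨′ 0F ≈′ fsuc y)

pair₀ : {z x y : Fin n} → Δ₀ (pair′ z x y)
pair₀ = ∧₀ ∈₀ (∧₀ ∈₀ (∀∈₀ (∨₀ ≈₀ ≈₀)))

-- p = (x , y)
opair′ : (p x y : Fin n) → Formula n
opair′ p x y = ∃∈′ p (pair′ 0F (fsuc x) (fsuc x))
            ∧′ ∃∈′ p (pair′ 0F (fsuc x) (fsuc y))
            ∧′ ∀∈′ p (pair′ 0F (fsuc x) (fsuc x) ∨′ pair′ 0F (fsuc x) (fsuc y))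

opair₀ : {p x y : Fin n} → Δ₀ (opair′ p x y)
opair₀ = ∧₀ (∃∈₀ pair₀) (∧₀ (∃∈₀ pair₀) (∀∈₀ (∨₀ pair₀ pair₀)))

-- (x , y) ∈ f
opair∈′ : (x y f : Fin n) → Formula n
opair∈′ x y f = ∃∈′ f (opair′ 0F (fsuc x) (fsuc y))

opair∈₀ : {x y f : Fin n} → Δ₀ (opair∈′ x y f)
opair∈₀ = ∃∈₀ opair₀

module SetsAndFunctions (M : ∈-Structure ℓ) (core : CoreAxioms M) where
  open ∈-Structure M
  open CoreAxioms core

  module ≈ = IsEquivalence isEquivalence

  ∈-respˡ : ∀ {x x′ y} → x ≈ x′ → x ∈ y → x′ ∈ y
  ∈-respˡ = proj₂ ∈-resp-≈

  ∈-respʳ : ∀ {x y y′} → y ≈ y′ → x ∈ y → x ∈ y′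
  ∈-respʳ = proj₁ ∈-resp-≈

  ⊆-antisym : ∀ {x y} → x ⊆ y → y ⊆ x → x ≈ y
  ⊆-antisym x⊆y y⊆x = extensionality _ _ λ z → mk⇔ (x⊆y z) (y⊆x z)

  ≈⇒⊆ : ∀ {x y} → x ≈ y → x ⊆ y
  ≈⇒⊆ eq z = ∈-respʳ eq

  infix 4 _≋_
  _≋_ : Rel (Vec Carrier n) ℓ
  ρ ≋ ρ′ = ∀ i → lookup ρ i ≈ lookup ρ′ i

  ≋-cons : ∀ {x x′} {ρ ρ′ : Vec Carrier n} → x ≈ x′ → ρ ≋ ρ′ → (x ∷ ρ) ≋ (x′ ∷ ρ′)
  ≋-cons e es zero     = e
  ≋-cons e es (fsuc i) = es i

  ⟦⟧-resp : (φ : Formula n) {ρ ρ′ : Vec Carrier n} → ρ ≋ ρ′ → ⟦ φ ⟧ ρ → ⟦ φ ⟧ ρ′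
  ⟦⟧-resp (i ∈′ j) e h        = ∈-respˡ (e i) (∈-respʳ (e j) h)
  ⟦⟧-resp (i ≈′ j) e h        = ≈.trans (≈.sym (e i)) (≈.trans h (e j))
  ⟦⟧-resp ⊤′ e h              = tt
  ⟦⟧-resp (φ ∧′ ψ) e (h , k)  = ⟦⟧-resp φ e h , ⟦⟧-resp ψ e k
  ⟦⟧-resp (φ ∨′ ψ) e (inj₁ h) = inj₁ (⟦⟧-resp φ e h)
  ⟦⟧-resp (φ ∨′ ψ) e (inj₂ h) = inj₂ (⟦⟧-resp ψ e h)
  ⟦⟧-resp (φ ⇒′ ψ) e h k      = ⟦⟧-resp ψ e (h (⟦⟧-resp φ (λ i → ≈.sym (e i)) k))
  ⟦⟧-resp (∀′ φ) e h x        = ⟦⟧-resp φ (≋-cons ≈.refl e) (h x)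
  ⟦⟧-resp (∃′ φ) e (x , h)    = x , ⟦⟧-resp φ (≋-cons ≈.refl e) h

  ∅ˢ : Carrier
  ∅ˢ = proj₁ empty

  ⋃ : Carrier → Carrier
  ⋃ a = proj₁ (union a)

  ⋃-spec : ∀ a {z} → z ∈ ⋃ a ⇔ (∃[ y ] y ∈ a × z ∈ y)
  ⋃-spec a = proj₂ (union a) _

  ｛_,_｝ : Carrier → Carrier → Carrier
  ｛ x , y ｝ = proj₁ (pairing x y)

  pair-spec : ∀ {x y z} → z ∈ ｛ x , y ｝ ⇔ (z ≈ x ⊎ z ≈ y)
  pair-spec = proj₂ (pairing _ _) _

  ∈-pair₁ : ∀ {x y} → x ∈ ｛ x , y ｝
  ∈-pair₁ = from pair-spec (inj₁ ≈.refl)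

  ∈-pair₂ : ∀ {x y} → y ∈ ｛ x , y ｝
  ∈-pair₂ = from pair-spec (inj₂ ≈.refl)

  pair⊆ : ∀ {x y a} → x ∈ a → y ∈ a → ｛ x , y ｝ ⊆ a
  pair⊆ x∈a y∈a z z∈ with to pair-spec z∈
  ... | inj₁ e = ∈-respˡ (≈.sym e) x∈a
  ... | inj₂ e = ∈-respˡ (≈.sym e) y∈a

  pair-cong : ∀ {x x′ y y′} → x ≈ x′ → y ≈ y′ → ｛ x , y ｝ ≈ ｛ x′ , y′ ｝
  pair-cong e e′ = ⊆-antisym
    (pair⊆ (∈-respˡ (≈.sym e) ∈-pair₁) (∈-respˡ (≈.sym e′) ∈-pair₂))
    (pair⊆ (∈-respˡ e ∈-pair₁) (∈-respˡ e′ ∈-pair₂))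

  ⟨_,_⟩ : Carrier → Carrier → Carrier
  ⟨ x , y ⟩ = ｛ ｛ x , x ｝ , ｛ x , y ｝ ｝

  ⟨⟩-cong : ∀ {x x′ y y′} → x ≈ x′ → y ≈ y′ → ⟨ x , y ⟩ ≈ ⟨ x′ , y′ ⟩
  ⟨⟩-cong e e′ = pair-cong (pair-cong e e) (pair-cong e e′)

  ∈-∈-⟨⟩ : ∀ {x y z w} → w ∈ z → z ∈ ⟨ x , y ⟩ → w ≈ x ⊎ w ≈ y
  ∈-∈-⟨⟩ w∈z z∈ with to pair-spec z∈
  ... | inj₁ e = inj₁ (Sum.reduce (to pair-spec (∈-respʳ e w∈z)))
  ... | inj₂ e = to pair-spec (∈-respʳ e w∈z)

  ⟨⟩-injective : ∀ {x x′ y y′} → ⟨ x , y ⟩ ≈ ⟨ x′ , y′ ⟩ → x ≈ x′ × y ≈ y′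
  ⟨⟩-injective {x} {x′} {y} {y′} e = x≈x′ , y≈y′
    where
    x′∈｛x｝ : x′ ∈ ｛ x , x ｝
    x′∈｛x｝ with to pair-spec (∈-respʳ e ∈-pair₁)
    ... | inj₁ q = ∈-respʳ (≈.sym q) ∈-pair₁
    ... | inj₂ q = ∈-respʳ (≈.sym q) ∈-pair₁

    x≈x′ : x ≈ x′
    x≈x′ = ≈.sym (Sum.reduce (to pair-spec x′∈｛x｝))

    y≈y′ : y ≈ y′
    y≈y′ with ∈-∈-⟨⟩ ∈-pair₂ (∈-respʳ e ∈-pair₂)
            | ∈-∈-⟨⟩ ∈-pair₂ (∈-respʳ (≈.sym e) ∈-pair₂)
    ... | inj₂ q | _      = q
    ... | inj₁ q | inj₂ r = ≈.sym r
    ... | inj₁ q | inj₁ r = ≈.trans q (≈.trans (≈.sym x≈x′) (≈.sym r))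

  ×⇔ : {A A′ B B′ : Set ℓ} → A ⇔ A′ → B ⇔ B′ → (A × B) ⇔ (A′ × B′)
  ×⇔ e e′ = mk⇔ (λ (h , k) → to e h , to e′ k) (λ (h , k) → from e h , from e′ k)

  ⊎⇔ : {A A′ B B′ : Set ℓ} → A ⇔ A′ → B ⇔ B′ → (A ⊎ B) ⇔ (A′ ⊎ B′)
  ⊎⇔ e e′ = mk⇔ (Sum.map (to e) (to e′)) (Sum.map (from e) (from e′))

  ∃∈⇔ : ∀ {a} {P Q : Carrier → Set ℓ} → (∀ x → P x ⇔ Q x) →
    (∃[ x ] x ∈ a × P x) ⇔ (∃[ x ] x ∈ a × Q x)
  ∃∈⇔ e = mk⇔ (λ (x , x∈a , h) → x , x∈a , to (e x) h)
              (λ (x , x∈a , h) → x , x∈a , from (e x) h)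

  ∀∈⇔ : ∀ {a} {P Q : Carrier → Set ℓ} → (∀ x → P x ⇔ Q x) →
    (∀ x → x ∈ a → P x) ⇔ (∀ x → x ∈ a → Q x)
  ∀∈⇔ e = mk⇔ (λ h x x∈a → to (e x) (h x x∈a)) (λ h x x∈a → from (e x) (h x x∈a))

  pair′-spec : (ρ : Vec Carrier n) (z x y : Fin n) →
    ⟦ pair′ z x y ⟧ ρ ⇔ lookup ρ z ≈ ｛ lookup ρ x , lookup ρ y ｝
  pair′-spec ρ z x y = mk⇔
    (λ (x∈z , y∈z , h) → ⊆-antisym
      (λ w w∈z → from pair-spec (h w w∈z)) (pair⊆ x∈z y∈z))
    (λ e → ∈-respʳ (≈.sym e) ∈-pair₁ , ∈-respʳ (≈.sym e) ∈-pair₂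
         , λ w w∈z → to pair-spec (∈-respʳ e w∈z))

  opair′-spec : (ρ : Vec Carrier n) (p x y : Fin n) →
    ⟦ opair′ p x y ⟧ ρ ⇔ lookup ρ p ≈ ⟨ lookup ρ x , lookup ρ y ⟩
  opair′-spec ρ p x y = mk⇔
    (λ h → let ((s , s∈p , es) , (t , t∈p , et) , k) = to unfold h in ⊆-antisym
      (λ w w∈p → from pair-spec (k w w∈p))
      (pair⊆ (∈-respˡ es s∈p) (∈-respˡ et t∈p)))
    (λ e → from unfold
      ( (_ , ∈-respʳ (≈.sym e) ∈-pair₁ , ≈.refl)
      , (_ , ∈-respʳ (≈.sym e) ∈-pair₂ , ≈.refl)
      , λ w w∈p → to pair-spec (∈-respʳ e w∈p)))
    where
    xᵥ = lookup ρ x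
    yᵥ = lookup ρ y
    pᵥ = lookup ρ p

    unfold : ⟦ opair′ p x y ⟧ ρ ⇔
      ((∃[ s ] s ∈ pᵥ × s ≈ ｛ xᵥ , xᵥ ｝) × (∃[ t ] t ∈ pᵥ × t ≈ ｛ xᵥ , yᵥ ｝)
        × (∀ w → w ∈ pᵥ → w ≈ ｛ xᵥ , xᵥ ｝ ⊎ w ≈ ｛ xᵥ , yᵥ ｝))
    unfold = ×⇔ (∃∈⇔ λ s → pair′-spec (s ∷ ρ) 0F (fsuc x) (fsuc x))
            (×⇔ (∃∈⇔ λ t → pair′-spec (t ∷ ρ) 0F (fsuc x) (fsuc y))
                (∀∈⇔ λ w → ⊎⇔ (pair′-spec (w ∷ ρ) 0F (fsuc x) (fsuc x))
                              (pair′-spec (w ∷ ρ) 0F (fsuc x) (fsuc y))))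

  opair∈′-spec : (ρ : Vec Carrier n) (x y f : Fin n) →
    ⟦ opair∈′ x y f ⟧ ρ ⇔ ⟨ lookup ρ x , lookup ρ y ⟩ ∈ lookup ρ f
  opair∈′-spec ρ x y f = mk⇔
    (λ (p , p∈f , h) → ∈-respˡ (to (opair′-spec (p ∷ ρ) 0F (fsuc x) (fsuc y)) h) p∈f)
    (λ h → _ , h , from (opair′-spec (_ ∷ ρ) 0F (fsuc x) (fsuc y)) ≈.refl)

  record Δ₀-Operation : Set ℓ where
    field
      op    : Carrier → Carrier → Carrier
      graph : ∀ {n} → (w x y : Fin n) → Formula n
      isΔ₀  : ∀ {n} {w x y : Fin n} → Δ₀ (graph w x y)
      spec  : ∀ {n} (ρ : Vec Carrier n) (w x y : Fin n) →
              ⟦ graph w x y ⟧ ρ ⇔ lookup ρ w ≈ op (lookup ρ x) (lookup ρ y)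

  pairOp : Δ₀-Operation
  pairOp = record { op = ｛_,_｝ ; graph = pair′ ; isΔ₀ = pair₀ ; spec = pair′-spec }

  opairOp : Δ₀-Operation
  opairOp = record { op = ⟨_,_⟩ ; graph = opair′ ; isΔ₀ = opair₀ ; spec = opair′-spec }

  -- {op x y | x ∈ a, y ∈ b} exists, provided that c and d bound the images
  -- in the two nested uses of limited replacement.
  module _ (O : Δ₀-Operation) (a b c d : Carrier)
    (bound-c : ∀ {x y z} → x ∈ a → y ∈ b → z ∈ Δ₀-Operation.op O x y → z ⊆ c)
    (bound-d : ∀ {x y} → x ∈ a → y ∈ b → Δ₀-Operation.op O x y ⊆ d)
    where
    open Δ₀-Operation O

    private
      IsRow : Carrier → Carrier → Set ℓ
      IsRow x q = ∀ w → w ∈ q ⇔ (∃[ y ] y ∈ b × w ≈ op x y)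

      row : ∀ x → x ∈ a → ∃[ q ] IsRow x q
      row x x∈a = proj₁ replaced , λ w → mk⇔
        (λ w∈q → to (unfold w) (to (proj₂ replaced w) w∈q))
        (λ h → from (proj₂ replaced w) (from (unfold w) h))
        where
        sp : ∀ w y → ⟦ graph 1F 2F 0F ⟧ (y ∷ w ∷ x ∷ []) ⇔ w ≈ op x y
        sp w y = spec (y ∷ w ∷ x ∷ []) 1F 2F 0F

        unfold : ∀ w → (∃[ y ] y ∈ b × ⟦ graph 1F 2F 0F ⟧ (y ∷ w ∷ x ∷ [])) ⇔
                       (∃[ y ] y ∈ b × w ≈ op x y)
        unfold w = ∃∈⇔ (sp w)

        replaced : ∃[ q ] ∀ w → w ∈ q ⇔
          (∃[ y ] y ∈ b × ⟦ graph 1F 2F 0F ⟧ (y ∷ w ∷ x ∷ []))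
        replaced = limited-Δ₀-replacement (graph 1F 2F 0F) isΔ₀ (x ∷ []) b c
          (λ y y∈b → op x y , from (sp _ y) ≈.refl , λ h → ≈.sym (to (sp _ y) h))
          (λ y y∈b w h z z∈w → bound-c x∈a y∈b (∈-respʳ (to (sp w y) h) z∈w))

      -- q = {op x y | y ∈ b}, in the variables x , q , b
      rowφ : Formula 3
      rowφ = ∀∈′ 1F (∃∈′ 3F (graph 1F 2F 0F)) ∧′ ∀∈′ 2F (∃∈′ 2F (graph 0F 2F 1F))

      rowφ-spec : ∀ x q → ⟦ rowφ ⟧ (x ∷ q ∷ b ∷ []) ⇔ IsRow x q
      rowφ-spec x q = mk⇔
        (λ h → let (h₁ , h₂) = to unfold h in λ w → mk⇔ (h₁ w)
          (λ (y , y∈b , e) → let (w′ , w′∈q , e′) = h₂ y y∈b in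
            ∈-respˡ (≈.trans e′ (≈.sym e)) w′∈q))
        (λ h → from unfold ((λ w w∈q → to (h w) w∈q)
                         , (λ y y∈b → _ , from (h _) (y , y∈b , ≈.refl) , ≈.refl)))
        where
        unfold : ⟦ rowφ ⟧ (x ∷ q ∷ b ∷ []) ⇔
          ((∀ w → w ∈ q → ∃[ y ] y ∈ b × w ≈ op x y)
            × (∀ y → y ∈ b → ∃[ w ] w ∈ q × w ≈ op x y))
        unfold = ×⇔
          (∀∈⇔ λ w → ∃∈⇔ λ y → spec (y ∷ w ∷ x ∷ q ∷ b ∷ []) 1F 2F 0F)
          (∀∈⇔ λ y → ∃∈⇔ λ w → spec (w ∷ y ∷ x ∷ q ∷ b ∷ []) 0F 2F 1F)

      rows : ∃[ s ] ∀ q → q ∈ s ⇔ (∃[ x ] x ∈ a × ⟦ rowφ ⟧ (x ∷ q ∷ b ∷ []))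
      rows = limited-Δ₀-replacement rowφ
        (∧₀ (∀∈₀ (∃∈₀ isΔ₀)) (∀∈₀ (∃∈₀ isΔ₀))) (b ∷ []) a d
        (λ x x∈a → let (q , hq) = row x x∈a in q , from (rowφ-spec x q) hq , λ {q′} h →
          extensionality q q′ λ w → mk⇔
            (λ w∈q → from (to (rowφ-spec x q′) h w) (to (hq w) w∈q))
            (λ w∈q′ → from (hq w) (to (to (rowφ-spec x q′) h w) w∈q′)))
        (λ x x∈a q h z z∈q → let (y , y∈b , e) = to (to (rowφ-spec x q) h z) z∈q in
          λ w w∈z → bound-d x∈a y∈b w (∈-respʳ e w∈z))

    image₂ : ∃[ s ] ∀ w → w ∈ s ⇔ (∃[ x ] x ∈ a × ∃[ y ] y ∈ b × w ≈ op x y)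
    image₂ = ⋃ (proj₁ rows) , λ w → mk⇔
      (λ w∈ → let (q , q∈ , w∈q)  = to (⋃-spec _) w∈
                  (x , x∈a , h)   = to (proj₂ rows q) q∈
              in x , x∈a , to (to (rowφ-spec x q) h w) w∈q)
      (λ (x , x∈a , h) → let (q , hq) = row x x∈a in
        from (⋃-spec _) (q , from (proj₂ rows q) (x , x∈a , from (rowφ-spec x q) hq)
                        , from (hq w) h))

  _∪_ : Carrier → Carrier → Carrier
  a ∪ b = ⋃ ｛ a , b ｝

  ∪-introˡ : ∀ {a b x} → x ∈ a → x ∈ a ∪ b
  ∪-introˡ x∈a = from (⋃-spec _) (_ , ∈-pair₁ , x∈a)

  ∪-introʳ : ∀ {a b x} → x ∈ b → x ∈ a ∪ b
  ∪-introʳ x∈b = from (⋃-spec _) (_ , ∈-pair₂ , x∈b)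

  pairs : ∀ a → ∃[ s ] ∀ w → w ∈ s ⇔ (∃[ x ] x ∈ a × ∃[ y ] y ∈ a × w ≈ ｛ x , y ｝)
  pairs a = image₂ pairOp a a (⋃ a) a
    (λ x∈ y∈ z∈ w w∈z → from (⋃-spec a) (_ , pair⊆ x∈ y∈ _ z∈ , w∈z))
    pair⊆

  -- This and later definitions are opaque only to keep their large
  -- normal forms out of conversion checking.
  opaque
    product : ∀ a b → ∃[ s ] ∀ w → w ∈ s ⇔ (∃[ x ] x ∈ a × ∃[ y ] y ∈ b × w ≈ ⟨ x , y ⟩)
    product a b = image₂ opairOp a b (a ∪ b) (proj₁ (pairs (a ∪ b)))
      (λ x∈a y∈b z∈ w w∈z → [ (λ e → ∈-respˡ (≈.sym e) (∪-introˡ x∈a))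
                            , (λ e → ∈-respˡ (≈.sym e) (∪-introʳ y∈b)) ]′ (∈-∈-⟨⟩ w∈z z∈))
      (λ x∈a y∈b → pair⊆
        (from (proj₂ (pairs (a ∪ b)) _) (_ , ∪-introˡ x∈a , _ , ∪-introˡ x∈a , ≈.refl))
        (from (proj₂ (pairs (a ∪ b)) _) (_ , ∪-introˡ x∈a , _ , ∪-introʳ y∈b , ≈.refl)))

  infixr 6 _×ˢ_
  _×ˢ_ : Carrier → Carrier → Carrier
  a ×ˢ b = proj₁ (product a b)

  ×ˢ-spec : ∀ {a b w} → w ∈ a ×ˢ b ⇔ (∃[ x ] x ∈ a × ∃[ y ] y ∈ b × w ≈ ⟨ x , y ⟩)
  ×ˢ-spec = proj₂ (product _ _) _

  infix 4 _⟶_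
  record _⟶_ (a b : Carrier) : Set ℓ where
    field
      graph      : Carrier
      relation   : ∀ p → p ∈ graph → ∃[ x ] x ∈ a × ∃[ y ] y ∈ b × p ≈ ⟨ x , y ⟩
      functional : ∀ x → x ∈ a → ∃! _≈_ (λ y → ⟨ x , y ⟩ ∈ graph)

    source : ∀ {x y} → ⟨ x , y ⟩ ∈ graph → x ∈ a
    source h = let (_ , x∈a , _ , _ , e) = relation _ h in
      ∈-respˡ (≈.sym (proj₁ (⟨⟩-injective e))) x∈a

    target : ∀ {x y} → ⟨ x , y ⟩ ∈ graph → y ∈ b
    target h = let (_ , _ , _ , y∈b , e) = relation _ h in
      ∈-respˡ (≈.sym (proj₂ (⟨⟩-injective e))) y∈b

    value : ∀ {x} → x ∈ a → Carrier
    value x∈a = proj₁ (functional _ x∈a)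

    value∈graph : ∀ {x} (x∈a : x ∈ a) → ⟨ x , value x∈a ⟩ ∈ graph
    value∈graph x∈a = proj₁ (proj₂ (functional _ x∈a))

    single-valued : ∀ {x y y′} → ⟨ x , y ⟩ ∈ graph → ⟨ x , y′ ⟩ ∈ graph → y ≈ y′
    single-valued h h′ = let (_ , _ , u) = functional _ (source h) in
      ≈.trans (≈.sym (u h)) (u h′)

  open _⟶_ public

  _↦_∈_ : ∀ {a b} → Carrier → Carrier → a ⟶ b → Set ℓ
  x ↦ y ∈ f = ⟨ x , y ⟩ ∈ graph f

  infix 4 _≈ᶠ_
  _≈ᶠ_ : ∀ {a b} → Rel (a ⟶ b) ℓ
  f ≈ᶠ g = graph f ≈ graph g

  ≈ᶠ-intro : ∀ {a b} {f g : a ⟶ b} → (∀ {x y} → x ↦ y ∈ f → x ↦ y ∈ g) → f ≈ᶠ g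
  ≈ᶠ-intro {f = f} {g} h = ⊆-antisym
    (λ p p∈f → let (x , _ , y , _ , e) = relation f p p∈f in
      ∈-respˡ (≈.sym e) (h (∈-respˡ e p∈f)))
    (λ p p∈g → let (x , x∈a , y , _ , e) = relation g p p∈g
                   k = value∈graph f x∈a
                   e′ = single-valued g (h k) (∈-respˡ e p∈g)
               in ∈-respˡ (≈.trans (⟨⟩-cong ≈.refl e′) (≈.sym e)) k)

  ≈ᶠ-elim : ∀ {a b} {f g : a ⟶ b} → f ≈ᶠ g → ∀ {x y} → x ↦ y ∈ f → x ↦ y ∈ g
  ≈ᶠ-elim e = ∈-respʳ e

  -- A total single-valued Δ₀ relation is a function.  The variables of φ
  -- are the value y, the argument x, the pair (x , y), the sets a and b,
  -- and the parameters.
  module _ (φ : Formula (5 + n)) (isΔ₀ : Δ₀ φ) (ρ : Vec Carrier n) (a b : Carrier) where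

    private
      Represents : (Carrier → Carrier → Set ℓ) → Set ℓ
      Represents R = ∀ x y → ⟦ φ ⟧ (y ∷ x ∷ ⟨ x , y ⟩ ∷ a ∷ b ∷ ρ) ⇔ R x y

      membership : Formula (3 + n)
      membership = ∃∈′ 1F (∃∈′ 3F (opair′ 2F 1F 0F ∧′ φ))

      s : ∃[ s ] ∀ p → p ∈ s ⇔ (p ∈ a ×ˢ b × ⟦ membership ⟧ (p ∷ a ∷ b ∷ ρ))
      s = Δ₀-separation membership
        (∃∈₀ (∃∈₀ (∧₀ opair₀ isΔ₀))) (a ∷ b ∷ ρ) (a ×ˢ b)

      s-spec : ∀ x y → ⟨ x , y ⟩ ∈ proj₁ s ⇔
        (x ∈ a × y ∈ b × ⟦ φ ⟧ (y ∷ x ∷ ⟨ x , y ⟩ ∷ a ∷ b ∷ ρ))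
      s-spec x y = mk⇔
        (λ h →
          let (_ , x′ , x′∈a , y′ , y′∈b , hp , r) = to (proj₂ s _) h
              (e , e′) = ⟨⟩-injective
                (to (opair′-spec (y′ ∷ x′ ∷ ⟨ x , y ⟩ ∷ a ∷ b ∷ ρ) 2F 1F 0F) hp)
          in ∈-respˡ (≈.sym e) x′∈a , ∈-respˡ (≈.sym e′) y′∈b
           , ⟦⟧-resp φ (≋-cons (≈.sym e′) (≋-cons (≈.sym e) (λ _ → ≈.refl))) r)
        (λ (x∈a , y∈b , r) → from (proj₂ s _)
          ( from ×ˢ-spec (x , x∈a , y , y∈b , ≈.refl)
          , x , x∈a , y , y∈b
          , from (opair′-spec (y ∷ x ∷ ⟨ x , y ⟩ ∷ a ∷ b ∷ ρ) 2F 1F 0F) ≈.refl , r))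

    opaque
      define : {R : Carrier → Carrier → Set ℓ} → Represents R →
        (∀ {x} → x ∈ a → ∃[ y ] y ∈ b × R x y) →
        (∀ {x y y′} → x ∈ a → y ∈ b → y′ ∈ b → R x y → R x y′ → y ≈ y′) →
        Σ[ f ∈ a ⟶ b ] (∀ {x y} → x ↦ y ∈ f ⇔ (x ∈ a × y ∈ b × R x y))
      define rep total single = record
        { graph      = proj₁ s
        ; relation   = λ p p∈ → to ×ˢ-spec (proj₁ (to (proj₂ s p) p∈))
        ; functional = λ x x∈a →
            let (y , y∈b , r) = total x∈a in
            y , from (s-spec x y) (x∈a , y∈b , from (rep x y) r) , λ h →
              let (_ , y′∈b , r′) = to (s-spec x _) h in
              single x∈a y∈b y′∈b r (to (rep x _) r′)
        } , λ {x} {y} → mk⇔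
          (λ h → let (x∈a , y∈b , r) = to (s-spec x y) h in x∈a , y∈b , to (rep x y) r)
          (λ (x∈a , y∈b , r) → from (s-spec x y) (x∈a , y∈b , from (rep x y) r))

  opaque
    id-def : ∀ a → Σ[ f ∈ a ⟶ a ] (∀ {x y} → x ↦ y ∈ f ⇔ (x ∈ a × y ∈ a × x ≈ y))
    id-def a = define (1F ≈′ 0F) ≈₀ [] a a (λ x y → mk⇔ (λ e → e) (λ e → e))
      (λ x∈a → _ , x∈a , ≈.refl)
      (λ _ _ _ e e′ → ≈.trans (≈.sym e) e′)

  idᶠ : ∀ {a} → a ⟶ a
  idᶠ = proj₁ (id-def _)

  id-spec : ∀ {a x y} → x ↦ y ∈ idᶠ {a} ⇔ (x ∈ a × x ≈ y)
  id-spec {a} {x} {y} = mk⇔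
    (λ h → let (x∈a , _ , e) = to (proj₂ (id-def a) {x} {y}) h in x∈a , e)
    (λ (x∈a , e) → from (proj₂ (id-def a) {x} {y}) (x∈a , ∈-respˡ e x∈a , e))

  module _ {a b c : Carrier} (g : b ⟶ c) (f : a ⟶ b) where

    private
      IsComposite : Carrier → Carrier → Set ℓ
      IsComposite x z = ∃[ y ] y ∈ b × x ↦ y ∈ f × y ↦ z ∈ g

      -- The parameters are b , f , g.
      ∘φ : Formula 8
      ∘φ = ∃∈′ 5F (opair∈′ 2F 0F 7F ∧′ opair∈′ 0F 1F 8F)

      ∘φ-spec : ∀ x z →
        ⟦ ∘φ ⟧ (z ∷ x ∷ ⟨ x , z ⟩ ∷ a ∷ c ∷ b ∷ graph f ∷ graph g ∷ []) ⇔ IsComposite x z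
      ∘φ-spec x z = ∃∈⇔ λ y →
        let ρ = y ∷ z ∷ x ∷ ⟨ x , z ⟩ ∷ a ∷ c ∷ b ∷ graph f ∷ graph g ∷ [] in
        ×⇔ (opair∈′-spec ρ 2F 0F 7F) (opair∈′-spec ρ 0F 1F 8F)

      ∘-total : ∀ {x} → x ∈ a → ∃[ z ] z ∈ c × IsComposite x z
      ∘-total x∈a =
        let h = value∈graph f x∈a
            k = value∈graph g (target f h)
        in _ , target g k , _ , target f h , h , k

      ∘-single : ∀ {x z z′} → x ∈ a → z ∈ c → z′ ∈ c →
        IsComposite x z → IsComposite x z′ → z ≈ z′
      ∘-single _ _ _ (_ , _ , h , k) (_ , _ , h′ , k′) =
        single-valued g (∈-respˡ (⟨⟩-cong (single-valued f h h′) ≈.refl) k) k′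

    opaque
      ∘-def : Σ[ h ∈ a ⟶ c ] (∀ {x z} → x ↦ z ∈ h ⇔ (x ∈ a × z ∈ c × IsComposite x z))
      ∘-def = define ∘φ (∃∈₀ (∧₀ opair∈₀ opair∈₀)) (b ∷ graph f ∷ graph g ∷ []) a c
        {R = IsComposite} ∘φ-spec ∘-total ∘-single

    infixr 9 _∘ᶠ_
    _∘ᶠ_ : a ⟶ c
    _∘ᶠ_ = proj₁ ∘-def

    ∘-spec : ∀ {x z} → x ↦ z ∈ _∘ᶠ_ ⇔ (∃[ y ] x ↦ y ∈ f × y ↦ z ∈ g)
    ∘-spec {x} {z} = mk⇔
      (λ h → let (_ , _ , y , _ , k , l) = to (proj₂ ∘-def {x} {z}) h in y , k , l)
      (λ (y , k , l) → from (proj₂ ∘-def {x} {z}) (source f k , target g l , y , target f k , k , l))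

  𝟏ˢ : Carrier
  𝟏ˢ = ｛ ∅ˢ , ∅ˢ ｝

  𝟏ˢ-unique : ∀ {x y} → x ∈ 𝟏ˢ → y ∈ 𝟏ˢ → x ≈ y
  𝟏ˢ-unique h k =
    ≈.trans (Sum.reduce (to pair-spec h)) (≈.sym (Sum.reduce (to pair-spec k)))

  opaque
    !-def : ∀ a → Σ[ f ∈ a ⟶ 𝟏ˢ ] (∀ {x y} → x ↦ y ∈ f ⇔ (x ∈ a × y ∈ 𝟏ˢ × ⊤ {ℓ}))
    !-def a = define ⊤′ ⊤₀ [] a 𝟏ˢ (λ x y → mk⇔ (λ e → e) (λ e → e))
      (λ _ → ∅ˢ , ∈-pair₁ , tt)
      (λ _ h k _ _ → 𝟏ˢ-unique h k)

  !ᶠ : ∀ {a} → a ⟶ 𝟏ˢ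
  !ᶠ = proj₁ (!-def _)

  !ᶠ-spec : ∀ {a x y} → x ↦ y ∈ !ᶠ {a} ⇔ (x ∈ a × y ∈ 𝟏ˢ)
  !ᶠ-spec {a} {x} {y} = mk⇔
    (λ h → let (x∈a , y∈1 , _) = to (proj₂ (!-def a) {x} {y}) h in x∈a , y∈1)
    (λ (x∈a , y∈) → from (proj₂ (!-def a) {x} {y}) (x∈a , y∈ , tt))

  module _ {a b c : Carrier} (f : a ⟶ c) (g : b ⟶ c) where

    private
      -- The variables are the element p and a , b , c , f , g.
      pbφ : Formula 6
      pbφ = ∃∈′ 1F (∃∈′ 3F (∃∈′ 5F
        (opair′ 3F 2F 1F ∧′ opair∈′ 2F 0F 7F ∧′ opair∈′ 1F 0F 8F)))

      InPb : Carrier → Set ℓ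
      InPb p = ∃[ x ] x ∈ a × ∃[ y ] y ∈ b × ∃[ z ] z ∈ c ×
        p ≈ ⟨ x , y ⟩ × x ↦ z ∈ f × y ↦ z ∈ g

      pbφ-spec : ∀ p → ⟦ pbφ ⟧ (p ∷ a ∷ b ∷ c ∷ graph f ∷ graph g ∷ []) ⇔ InPb p
      pbφ-spec p = ∃∈⇔ λ x → ∃∈⇔ λ y → ∃∈⇔ λ z →
        let ρ = z ∷ y ∷ x ∷ p ∷ a ∷ b ∷ c ∷ graph f ∷ graph g ∷ [] in
        ×⇔ (opair′-spec ρ 3F 2F 1F)
           (×⇔ (opair∈′-spec ρ 2F 0F 7F) (opair∈′-spec ρ 1F 0F 8F))

    opaque
      pb-def : ∃[ s ] ∀ p → p ∈ s ⇔ InPb p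
      pb-def = proj₁ s , λ p → mk⇔
        (λ h → to (pbφ-spec p) (proj₂ (to (proj₂ s p) h)))
        (λ (x , x∈a , y , y∈b , z , z∈c , e , h) → from (proj₂ s p)
          ( from ×ˢ-spec (x , x∈a , y , y∈b , e)
          , from (pbφ-spec p) (x , x∈a , y , y∈b , z , z∈c , e , h)))
        where
        ρ : Vec Carrier 5
        ρ = a ∷ b ∷ c ∷ graph f ∷ graph g ∷ []

        s : ∃[ s ] ∀ p → p ∈ s ⇔ (p ∈ a ×ˢ b × ⟦ pbφ ⟧ (p ∷ ρ))
        s = Δ₀-separation pbφ
          (∃∈₀ (∃∈₀ (∃∈₀ (∧₀ opair₀ (∧₀ opair∈₀ opair∈₀))))) ρ (a ×ˢ b)

    -- {(x , y) ∈ a × b | f x = g y}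
    pb : Carrier
    pb = proj₁ pb-def

    pb-spec : ∀ {p} → p ∈ pb ⇔
      (∃[ x ] ∃[ y ] p ≈ ⟨ x , y ⟩ × ∃[ z ] x ↦ z ∈ f × y ↦ z ∈ g)
    pb-spec {p} = mk⇔
      (λ h → let (x , _ , y , _ , z , _ , e , k , l) = to (proj₂ pb-def p) h in
        x , y , e , z , k , l)
      (λ (x , y , e , z , k , l) → from (proj₂ pb-def p)
        (x , source f k , y , source g l , z , target f k , e , k , l))

    pb-elim : ∀ {x y} → ⟨ x , y ⟩ ∈ pb → ∃[ z ] x ↦ z ∈ f × y ↦ z ∈ g
    pb-elim h = let (x′ , y′ , e , z , k , l) = to pb-spec h
                    (ex , ey) = ⟨⟩-injective e
                in z , ∈-respˡ (⟨⟩-cong (≈.sym ex) ≈.refl) k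
                     , ∈-respˡ (⟨⟩-cong (≈.sym ey) ≈.refl) l

    pb-intro : ∀ {x y z} → x ↦ z ∈ f → y ↦ z ∈ g → ⟨ x , y ⟩ ∈ pb
    pb-intro k l = from pb-spec (_ , _ , ≈.refl , _ , k , l)

    pb-source : ∀ {x y} → ⟨ x , y ⟩ ∈ pb → x ∈ a × y ∈ b
    pb-source h = let (_ , k , l) = pb-elim h in source f k , source g l

    private
      IsFst IsSnd : Carrier → Carrier → Set ℓ
      IsFst p x = ∃[ y ] y ∈ b × p ≈ ⟨ x , y ⟩
      IsSnd p y = ∃[ x ] x ∈ a × p ≈ ⟨ x , y ⟩

    private
      π₁-φ : Formula 6
      π₁-φ = ∃∈′ 5F (opair′ 2F 1F 0F)

      π₁-φ-spec : ∀ p x →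
        ⟦ π₁-φ ⟧ (x ∷ p ∷ ⟨ p , x ⟩ ∷ pb ∷ a ∷ b ∷ []) ⇔ IsFst p x
      π₁-φ-spec p x = ∃∈⇔ λ y →
        opair′-spec (y ∷ x ∷ p ∷ ⟨ p , x ⟩ ∷ pb ∷ a ∷ b ∷ []) 2F 1F 0F

      π₁-total : ∀ {p} → p ∈ pb → ∃[ x ] x ∈ a × IsFst p x
      π₁-total p∈ = let (x , y , e , z , k , l) = to pb-spec p∈ in
        x , source f k , y , source g l , e

      π₁-single : ∀ {p x x′} → p ∈ pb → x ∈ a → x′ ∈ a →
        IsFst p x → IsFst p x′ → x ≈ x′
      π₁-single _ _ _ (_ , _ , e) (_ , _ , e′) =
        proj₁ (⟨⟩-injective (≈.trans (≈.sym e) e′))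

    opaque
      π₁-def : Σ[ h ∈ pb ⟶ a ] (∀ {p x} → p ↦ x ∈ h ⇔ (p ∈ pb × x ∈ a × IsFst p x))
      π₁-def = define π₁-φ (∃∈₀ opair₀) (b ∷ []) pb a
        {R = IsFst} π₁-φ-spec π₁-total π₁-single

    π₁ : pb ⟶ a
    π₁ = proj₁ π₁-def

    π₁-spec : ∀ {p x} → p ↦ x ∈ π₁ ⇔ (p ∈ pb × ∃[ y ] p ≈ ⟨ x , y ⟩)
    π₁-spec {p} {x} = mk⇔
      (λ h → let (p∈ , _ , y , _ , e) = to (proj₂ π₁-def {p} {x}) h in p∈ , y , e)
      (λ (p∈ , y , e) → let (x∈a , y∈b) = pb-source (∈-respˡ e p∈) in
        from (proj₂ π₁-def {p} {x}) (p∈ , x∈a , y , y∈b , e))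

    private
      π₂-φ : Formula 6
      π₂-φ = ∃∈′ 5F (opair′ 2F 0F 1F)

      π₂-φ-spec : ∀ p y →
        ⟦ π₂-φ ⟧ (y ∷ p ∷ ⟨ p , y ⟩ ∷ pb ∷ b ∷ a ∷ []) ⇔ IsSnd p y
      π₂-φ-spec p y = ∃∈⇔ λ x →
        opair′-spec (x ∷ y ∷ p ∷ ⟨ p , y ⟩ ∷ pb ∷ b ∷ a ∷ []) 2F 0F 1F

      π₂-total : ∀ {p} → p ∈ pb → ∃[ y ] y ∈ b × IsSnd p y
      π₂-total p∈ = let (x , y , e , z , k , l) = to pb-spec p∈ in
        y , source g l , x , source f k , e

      π₂-single : ∀ {p y y′} → p ∈ pb → y ∈ b → y′ ∈ b →
        IsSnd p y → IsSnd p y′ → y ≈ y′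
      π₂-single _ _ _ (_ , _ , e) (_ , _ , e′) =
        proj₂ (⟨⟩-injective (≈.trans (≈.sym e) e′))

    opaque
      π₂-def : Σ[ h ∈ pb ⟶ b ] (∀ {p y} → p ↦ y ∈ h ⇔ (p ∈ pb × y ∈ b × IsSnd p y))
      π₂-def = define π₂-φ (∃∈₀ opair₀) (a ∷ []) pb b
        {R = IsSnd} π₂-φ-spec π₂-total π₂-single

    π₂ : pb ⟶ b
    π₂ = proj₁ π₂-def

    π₂-spec : ∀ {p y} → p ↦ y ∈ π₂ ⇔ (p ∈ pb × ∃[ x ] p ≈ ⟨ x , y ⟩)
    π₂-spec {p} {y} = mk⇔
      (λ h → let (p∈ , _ , x , _ , e) = to (proj₂ π₂-def {p} {y}) h in p∈ , x , e)
      (λ (p∈ , x , e) → let (x∈a , y∈b) = pb-source (∈-respˡ e p∈) in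
        from (proj₂ π₂-def {p} {y}) (p∈ , y∈b , x , x∈a , e))

    module _ {d : Carrier} (h : d ⟶ a) (k : d ⟶ b) (eq : f ∘ᶠ h ≈ᶠ g ∘ᶠ k) where

      private
        IsTuple : Carrier → Carrier → Set ℓ
        IsTuple w p = ∃[ x ] x ∈ a × ∃[ y ] y ∈ b × p ≈ ⟨ x , y ⟩ × w ↦ x ∈ h × w ↦ y ∈ k

        -- The parameters are a , b , h , k.
        tupleφ : Formula 9
        tupleφ = ∃∈′ 5F (∃∈′ 7F
          (opair′ 2F 1F 0F ∧′ opair∈′ 3F 1F 9F ∧′ opair∈′ 3F 0F (fsuc 9F)))

        in-pb : ∀ {w x y} → w ↦ x ∈ h → w ↦ y ∈ k → ⟨ x , y ⟩ ∈ pb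
        in-pb m n =
          let m′ = value∈graph f (target h m)
              (y′ , n′ , l) = to (∘-spec g k) (≈ᶠ-elim {f = f ∘ᶠ h} {g ∘ᶠ k} eq
                (from (∘-spec f h) (_ , m , m′)))
          in pb-intro m′ (∈-respˡ (⟨⟩-cong (single-valued k n′ n) ≈.refl) l)

        tupleφ-spec : ∀ w p →
          ⟦ tupleφ ⟧ (p ∷ w ∷ ⟨ w , p ⟩ ∷ d ∷ pb ∷ a ∷ b ∷ graph h ∷ graph k ∷ []) ⇔ IsTuple w p
        tupleφ-spec w p = ∃∈⇔ λ x → ∃∈⇔ λ y →
          let ρ = y ∷ x ∷ p ∷ w ∷ ⟨ w , p ⟩ ∷ d ∷ pb ∷ a ∷ b ∷ graph h ∷ graph k ∷ [] in
          ×⇔ (opair′-spec ρ 2F 1F 0F)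
             (×⇔ (opair∈′-spec ρ 3F 1F 9F) (opair∈′-spec ρ 3F 0F (fsuc 9F)))

        tuple-total : ∀ {w} → w ∈ d → ∃[ p ] p ∈ pb × IsTuple w p
        tuple-total w∈d =
          let m = value∈graph h w∈d
              n = value∈graph k w∈d
          in _ , in-pb m n , _ , target h m , _ , target k n , ≈.refl , m , n

        tuple-single : ∀ {w p p′} → w ∈ d → p ∈ pb → p′ ∈ pb →
          IsTuple w p → IsTuple w p′ → p ≈ p′
        tuple-single _ _ _ (_ , _ , _ , _ , e , m , n) (_ , _ , _ , _ , e′ , m′ , n′) =
          ≈.trans e (≈.trans
            (⟨⟩-cong (single-valued h m m′) (single-valued k n n′)) (≈.sym e′))

      opaque
        tuple-def : Σ[ t ∈ d ⟶ pb ] (∀ {w p} → w ↦ p ∈ t ⇔ (w ∈ d × p ∈ pb × IsTuple w p))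
        tuple-def = define tupleφ (∃∈₀ (∃∈₀ (∧₀ opair₀ (∧₀ opair∈₀ opair∈₀))))
          (a ∷ b ∷ graph h ∷ graph k ∷ []) d pb
          {R = IsTuple} tupleφ-spec tuple-total tuple-single

      tuple : d ⟶ pb
      tuple = proj₁ tuple-def

      tuple-spec : ∀ {w p} → w ↦ p ∈ tuple ⇔
        (∃[ x ] ∃[ y ] p ≈ ⟨ x , y ⟩ × w ↦ x ∈ h × w ↦ y ∈ k)
      tuple-spec {w} {p} = mk⇔
        (λ r → let (_ , _ , x , _ , y , _ , e , m , n) = to (proj₂ tuple-def {w} {p}) r in
          x , y , e , m , n)
        (λ (x , y , e , m , n) → from (proj₂ tuple-def {w} {p})
          ( source h m , ∈-respˡ (≈.sym e) (in-pb m n)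
          , x , target h m , y , target k n , e , m , n))

𝕊et : (M : ∈-Structure ℓ) → CoreAxioms M → Category ℓ
𝕊et M core = record
  { Obj           = ∈-Structure.Carrier M
  ; _⇒_           = _⟶_
  ; _≈_           = _≈ᶠ_
  ; id            = idᶠ
  ; _∘_           = _∘ᶠ_
  ; isEquivalence = record { refl = ≈.refl ; sym = ≈.sym ; trans = ≈.trans }
  ; identityˡ     = λ {_} {_} {f} → ≈ᶠ-intro {f = idᶠ ∘ᶠ f} {f} λ h →
      let (_ , k , l) = to (∘-spec idᶠ f) h
          (_ , e)     = to id-spec l
      in ∈-respˡ (⟨⟩-cong ≈.refl e) k
  ; identityʳ     = λ {_} {_} {f} → ≈ᶠ-intro {f = f ∘ᶠ idᶠ} {f} λ h →
      let (_ , k , l) = to (∘-spec f idᶠ) h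
          (_ , e)     = to id-spec k
      in ∈-respˡ (⟨⟩-cong (≈.sym e) ≈.refl) l
  ; assoc         = λ {_} {_} {_} {_} {f} {g} {h} →
      ≈ᶠ-intro {f = (h ∘ᶠ g) ∘ᶠ f} {h ∘ᶠ (g ∘ᶠ f)} λ r →
      let (_ , k , r′) = to (∘-spec (h ∘ᶠ g) f) r
          (_ , l , m)  = to (∘-spec h g) r′
      in from (∘-spec h (g ∘ᶠ f)) (_ , from (∘-spec g f) (_ , k , l) , m)
  ; ∘-resp-≈      = λ {_} {_} {_} {g} {g′} {f} {f′} e e′ →
      ≈ᶠ-intro {f = g ∘ᶠ f} {g′ ∘ᶠ f′} λ r →
      let (_ , k , l) = to (∘-spec g f) r
      in from (∘-spec g′ f′) (_ , ∈-respʳ e′ k , ∈-respʳ e l)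
  }
  where open SetsAndFunctions M core

𝕊et-finiteLimits : (M : ∈-Structure ℓ) (core : CoreAxioms M) → FiniteLimits (𝕊et M core)
𝕊et-finiteLimits M core = record
  { terminal = record
    { 𝟏        = 𝟏ˢ
    ; !        = !ᶠ
    ; !-unique = λ f → ≈ᶠ-intro {f = f} {g = !ᶠ} λ h →
        from !ᶠ-spec (source f h , target f h)
    }
  ; pullback = λ f g → record
    { P            = pb f g
    ; p₁           = π₁ f g
    ; p₂           = π₂ f g
    ; commute      = ≈ᶠ-intro {f = f ∘ᶠ π₁ f g} {g ∘ᶠ π₂ f g} λ r →
        let (x , r₁ , l)   = to (∘-spec f (π₁ f g)) r
            (p∈ , y , e)   = to (π₁-spec f g) r₁
            (z , l′ , m)   = pb-elim f g (∈-respˡ e p∈)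
        in from (∘-spec g (π₂ f g)) (y , from (π₂-spec f g) (p∈ , x , e)
             , ∈-respˡ (⟨⟩-cong ≈.refl (single-valued f l′ l)) m)
    ; universal    = tuple f g
    ; p₁∘universal = λ {_} {h} {k} {eq} →
        ≈ᶠ-intro {f = π₁ f g ∘ᶠ tuple f g h k eq} {h} λ r →
        let (p , t , q)             = to (∘-spec (π₁ f g) (tuple f g h k eq)) r
            (_ , _ , e , m , _)     = to (tuple-spec f g h k eq) t
            (_ , _ , e′)            = to (π₁-spec f g) q
        in ∈-respˡ (⟨⟩-cong ≈.refl (proj₁ (⟨⟩-injective (≈.trans (≈.sym e) e′)))) m
    ; p₂∘universal = λ {_} {h} {k} {eq} →
        ≈ᶠ-intro {f = π₂ f g ∘ᶠ tuple f g h k eq} {k} λ r →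
        let (p , t , q)             = to (∘-spec (π₂ f g) (tuple f g h k eq)) r
            (_ , _ , e , _ , n)     = to (tuple-spec f g h k eq) t
            (_ , _ , e′)            = to (π₂-spec f g) q
        in ∈-respˡ (⟨⟩-cong ≈.refl (proj₂ (⟨⟩-injective (≈.trans (≈.sym e) e′)))) n
    ; unique       = λ {_} {h} {k} {eq} i e₁ e₂ →
        ≈ᶠ-intro {f = i} {tuple f g h k eq} λ r →
        let p∈ = target i r
            (x , y , e , _) = to (pb-spec f g) p∈
        in from (tuple-spec f g h k eq) (x , y , e
             , ∈-respʳ e₁ (from (∘-spec (π₁ f g) i) (_ , r , from (π₁-spec f g) (p∈ , y , e)))
             , ∈-respʳ e₂ (from (∘-spec (π₂ f g) i) (_ , r , from (π₂-spec f g) (p∈ , x , e))))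
    }
  }
  where open SetsAndFunctions M core

{-# OPTIONS --safe #-}

-- A statement φ about 𝕊et(V) translates to one about V, so material collection
-- applies to it.  Collecting the pairs (u , X) with φ(u , X) gives a set W; its
-- first projection to U is surjective, hence the coequalizer of its kernel pair,
-- and the second components form the family {(y , w) | y = (u , X) ∈ W, w ∈ X}
-- over W.  Its fibre over y is only isomorphic to X, so one also needs that
-- categorical formulas are invariant under isomorphism.  For functions, collecting
-- the pairs (u , graph f) gives W, and the functions f are glued to a map over W
-- that restricts to them on the fibres.  Equalities need no cover, because every
-- point of A lies over an element of U.

module Submission where

open import Defs

open import Level using (Level)
open import Data.Nat.Base using (ℕ; _+_) renaming (suc to 1+)
open import Data.Fin.Base using (Fin) renaming (suc to fsuc)
open import Data.Fin using (#_)
open import Data.Fin.Patterns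
open import Data.Vec.Base using (Vec; []; _∷_; lookup)
open import Data.Product using (∃; _×_; _,_; proj₁; proj₂; Σ-syntax; ∃-syntax)
import Data.Sum.Base as Sum
open import Data.Unit.Polymorphic using (tt)
open import Function.Base using (id)
open import Function.Bundles using (_⇔_; mk⇔; Equivalence)
open import Relation.Binary.Bundles using (Setoid)
open import Relation.Binary.PropositionalEquality as ≡ using (_≡_)
import Relation.Binary.Reasoning.Setoid as SetoidReasoning

open Equivalence using (to; from)

-- Since only Δ₀-separation and limited Δ₀-replacement are at hand, φ can enter the construction
-- through material collection alone. The clause that every collected set belongs to some index
-- stands in for separation by φ: each member of W carries a φ-witness. Whatever is built from W
-- afterwards has to be cut out by a bounded formula from a set already known to exist; this is why
-- double unions and products with 1 occur as bounds. A second obstacle is dependent typing: fibres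
-- over ≈-equal elements are different objects, and an arrow between one pair of fibres is not an
-- arrow between the other pair. Two transfer principles deal with this. A collected set is only
-- isomorphic to the fibre that replaces it, so collection of sets relies on invariance under
-- isomorphism. For functions the fibres coincide up to ≈, and it is enough that the truth of a
-- formula depends only on the sets representing its environment.

private
  variable
    ℓ : Level
    n : ℕ

-- Invariance of categorical formulas under isomorphism

module IsoInvariance (C : Category ℓ) (T : Terminal C) where
  open Category C renaming (id to idC)
  open Terminal T
  open Satisfaction C T

  record Iso (X Y : Obj) : Set ℓ where
    field
      fwd  : X ⇒ Y
      bwd  : Y ⇒ X
      isoˡ : bwd ∘ fwd ≈ idC
      isoʳ : fwd ∘ bwd ≈ idC

  open Iso public

  private
    homSetoid : (X Y : Obj) → Setoid ℓ ℓ
    homSetoid X Y = record { isEquivalence = isEquivalence {X} {Y} }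

    module HomReasoning {X Y : Obj} = SetoidReasoning (homSetoid X Y)

  iso-refl : ∀ {X} → Iso X X
  iso-refl = record { fwd = idC ; bwd = idC ; isoˡ = identityˡ ; isoʳ = identityˡ }

  cancelʳ : ∀ {X Y Z} (i : Iso X Y) {f : Y ⇒ Z} → (f ∘ fwd i) ∘ bwd i ≈ f
  cancelʳ i = Eq.trans assoc (Eq.trans (∘-resp-≈ Eq.refl (isoʳ i)) identityʳ)

  cancelˡ : ∀ {X Y Z} (i : Iso Y Z) {f : X ⇒ Y} → bwd i ∘ (fwd i ∘ f) ≈ f
  cancelˡ i = Eq.trans (Eq.sym assoc) (Eq.trans (∘-resp-≈ (isoˡ i) Eq.refl) identityˡ)

  fwd-epic : ∀ {X Y Z} (i : Iso X Y) {f g : Y ⇒ Z} → f ∘ fwd i ≈ g ∘ fwd i → f ≈ g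
  fwd-epic i e = Eq.trans (Eq.sym (cancelʳ i)) (Eq.trans (∘-resp-≈ e Eq.refl) (cancelʳ i))

  fwd-monic : ∀ {X Y Z} (i : Iso Y Z) {f g : X ⇒ Y} → fwd i ∘ f ≈ fwd i ∘ g → f ≈ g
  fwd-monic i e = Eq.trans (Eq.sym (cancelˡ i)) (Eq.trans (∘-resp-≈ Eq.refl e) (cancelˡ i))

  infix  4 _≅_
  infixl 5 _,ₒ_ _,ₐ_

  -- An arrow variable requires a commuting square whose sides are the isomorphisms already chosen
  -- for its endpoints, hence the mutual definition with `ob-iso`.
  data _≅_ : ∀ {Γ} → Env Γ → Env Γ → Set ℓ
  ob-iso : ∀ {Γ} (X : Ob Γ) {γ γ′ : Env Γ} → γ ≅ γ′ → Iso (⟦ X ⟧ₒ γ) (⟦ X ⟧ₒ γ′)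

  data _≅_ where
    base : _≅_ {∅} tt tt
    _,ₒ_ : ∀ {Γ} {γ γ′ : Env Γ} {A A′ : Obj} →
           γ ≅ γ′ → Iso A A′ → _≅_ {Γ ▷Ob} (γ , A) (γ′ , A′)
    _,ₐ_ : ∀ {Γ} {X Y : Ob Γ} {γ γ′ : Env Γ}
           {f : ⟦ X ⟧ₒ γ ⇒ ⟦ Y ⟧ₒ γ} {f′ : ⟦ X ⟧ₒ γ′ ⇒ ⟦ Y ⟧ₒ γ′} (e : γ ≅ γ′) →
           f′ ∘ fwd (ob-iso X e) ≈ fwd (ob-iso Y e) ∘ f →
           _≅_ {Γ ▷ X ⇒ Y} (γ , f) (γ′ , f′)

  ob-iso one     base     = iso-refl
  ob-iso new     (_ ,ₒ i) = i
  ob-iso (wkₒ X) (e ,ₒ _) = ob-iso X e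
  ob-iso (wkₐ X) (e ,ₐ _) = ob-iso X e

  into-𝟙-unique : ∀ {Γ} (γ : Env Γ) {X} (f g : X ⇒ ⟦ 𝟙 Γ ⟧ₒ γ) → f ≈ g
  into-𝟙-unique {∅}         _       f g = Eq.trans (!-unique f) (Eq.sym (!-unique g))
  into-𝟙-unique {_ ▷Ob}     (γ , _) f g = into-𝟙-unique γ f g
  into-𝟙-unique {_ ▷ _ ⇒ _} (γ , _) f g = into-𝟙-unique γ f g

  natural-var : ∀ {Γ X Y} (x : ArrVar Γ X Y) {γ γ′ : Env Γ} (e : γ ≅ γ′) →
    ⟦ x ⟧ᵥ γ′ ∘ fwd (ob-iso X e) ≈ fwd (ob-iso Y e) ∘ ⟦ x ⟧ᵥ γ
  natural-var new     (_ ,ₐ s) = s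
  natural-var (wkₒ x) (e ,ₒ _) = natural-var x e
  natural-var (wkₐ x) (e ,ₐ _) = natural-var x e

  natural : ∀ {Γ X Y} (f : Arr Γ X Y) {γ γ′ : Env Γ} (e : γ ≅ γ′) →
    ⟦ f ⟧ₐ γ′ ∘ fwd (ob-iso X e) ≈ fwd (ob-iso Y e) ∘ ⟦ f ⟧ₐ γ
  natural (var x) e = natural-var x e
  natural id′     e = Eq.trans identityˡ (Eq.sym identityʳ)
  natural (_∘′_ {X} {Y} {Z} f g) {γ} {γ′} e = begin
    (⟦ f ⟧ₐ γ′ ∘ ⟦ g ⟧ₐ γ′) ∘ fwd (ob-iso X e)   ≈⟨ assoc ⟩
    ⟦ f ⟧ₐ γ′ ∘ (⟦ g ⟧ₐ γ′ ∘ fwd (ob-iso X e))   ≈⟨ ∘-resp-≈ Eq.refl (natural g e) ⟩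
    ⟦ f ⟧ₐ γ′ ∘ (fwd (ob-iso Y e) ∘ ⟦ g ⟧ₐ γ)    ≈⟨ Eq.sym assoc ⟩
    (⟦ f ⟧ₐ γ′ ∘ fwd (ob-iso Y e)) ∘ ⟦ g ⟧ₐ γ    ≈⟨ ∘-resp-≈ (natural f e) Eq.refl ⟩
    (fwd (ob-iso Z e) ∘ ⟦ f ⟧ₐ γ) ∘ ⟦ g ⟧ₐ γ     ≈⟨ assoc ⟩
    fwd (ob-iso Z e) ∘ (⟦ f ⟧ₐ γ ∘ ⟦ g ⟧ₐ γ)     ∎
    where open HomReasoning
  natural !′ {γ} {γ′} e = into-𝟙-unique γ′ _ _

  -- Conjugating with the isomorphisms of e extends e to any arrow on either side.
  conjugate : ∀ {X X′ Y Y′} (i : Iso X X′) (j : Iso Y Y′) (f : X ⇒ Y) →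
    (fwd j ∘ (f ∘ bwd i)) ∘ fwd i ≈ fwd j ∘ f
  conjugate i j f = Eq.trans assoc (∘-resp-≈ Eq.refl
    (Eq.trans assoc (Eq.trans (∘-resp-≈ Eq.refl (isoˡ i)) identityʳ)))

  conjugate⁻¹ : ∀ {X X′ Y Y′} (i : Iso X X′) (j : Iso Y Y′) (f : X′ ⇒ Y′) →
    f ∘ fwd i ≈ fwd j ∘ (bwd j ∘ (f ∘ fwd i))
  conjugate⁻¹ i j f = Eq.sym
    (Eq.trans (Eq.sym assoc) (Eq.trans (∘-resp-≈ (isoʳ j) Eq.refl) identityˡ))

  -- The absence of equality of objects makes this work: an object quantifier reuses the same object
  -- with the identity, and an arrow quantifier is matched by conjugation. The premise of `⇒′` is
  -- contravariant, so both directions have to be proved together.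
  invariant : ∀ {Γ} (φ : CatFormula Γ) {γ γ′ : Env Γ} → γ ≅ γ′ → ⟦ φ ⟧ γ ⇔ ⟦ φ ⟧ γ′
  invariant (_≈′_ {X} {Y} f g) e = mk⇔
    (λ h → fwd-epic (ob-iso X e) (Eq.trans (natural f e)
      (Eq.trans (∘-resp-≈ Eq.refl h) (Eq.sym (natural g e)))))
    (λ h → fwd-monic (ob-iso Y e) (Eq.trans (Eq.sym (natural f e))
      (Eq.trans (∘-resp-≈ h Eq.refl) (natural g e))))
  invariant ⊤′       e = mk⇔ id id
  invariant ⊥′       e = mk⇔ id id
  invariant (φ ∧′ ψ) e = mk⇔
    (λ (h , k) → to (invariant φ e) h , to (invariant ψ e) k)
    (λ (h , k) → from (invariant φ e) h , from (invariant ψ e) k)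
  invariant (φ ∨′ ψ) e = mk⇔
    (Sum.map (to (invariant φ e)) (to (invariant ψ e)))
    (Sum.map (from (invariant φ e)) (from (invariant ψ e)))
  invariant (φ ⇒′ ψ) e = mk⇔
    (λ h k → to (invariant ψ e) (h (from (invariant φ e) k)))
    (λ h k → from (invariant ψ e) (h (to (invariant φ e) k)))
  invariant (∀Ob φ)  e = mk⇔
    (λ h A → to (invariant φ (e ,ₒ iso-refl)) (h A))
    (λ h A → from (invariant φ (e ,ₒ iso-refl)) (h A))
  invariant (∃Ob φ)  e = mk⇔
    (λ (A , h) → A , to (invariant φ (e ,ₒ iso-refl)) h)
    (λ (A , h) → A , from (invariant φ (e ,ₒ iso-refl)) h)
  invariant (∀Arr X Y φ) e = mk⇔
    (λ h f → to (invariant φ (e ,ₐ conjugate⁻¹ (ob-iso X e) (ob-iso Y e) f)) (h _))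
    (λ h f → from (invariant φ (e ,ₐ conjugate (ob-iso X e) (ob-iso Y e) f)) (h _))
  invariant (∃Arr X Y φ) e = mk⇔
    (λ (f , h) → _ , to (invariant φ (e ,ₐ conjugate (ob-iso X e) (ob-iso Y e) f)) h)
    (λ (f , h) → _ , from (invariant φ (e ,ₐ conjugate⁻¹ (ob-iso X e) (ob-iso Y e) f)) h)

  ≅-refl : ∀ {Γ} (γ : Env Γ) → γ ≅ γ
  -- The square that `≅-refl` owes at an arrow variable comes from this. For a variable `X` it holds
  -- only by induction, which forces the mutual recursion.
  ob-iso-refl : ∀ {Γ} (X : Ob Γ) (γ : Env Γ) → fwd (ob-iso X (≅-refl γ)) ≈ idC

  ≅-arrow : ∀ {Γ} {X Y : Ob Γ} (γ : Env Γ) {f f′ : ⟦ X ⟧ₒ γ ⇒ ⟦ Y ⟧ₒ γ} →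
    f ≈ f′ → _≅_ {Γ ▷ X ⇒ Y} (γ , f) (γ , f′)
  ≅-arrow {X = X} {Y} γ e = ≅-refl γ ,ₐ
    Eq.trans (∘-resp-≈ (Eq.sym e) (ob-iso-refl X γ)) (Eq.trans identityʳ
    (Eq.sym (Eq.trans (∘-resp-≈ (ob-iso-refl Y γ) Eq.refl) identityˡ)))

  ≅-refl {∅}         _       = base
  ≅-refl {_ ▷Ob}     (γ , _) = ≅-refl γ ,ₒ iso-refl
  ≅-refl {_ ▷ _ ⇒ _} (γ , _) = ≅-arrow γ Eq.refl

  ob-iso-refl one     _       = Eq.refl
  ob-iso-refl new     _       = Eq.refl
  ob-iso-refl (wkₒ X) (γ , _) = ob-iso-refl X γ
  ob-iso-refl (wkₐ X) (γ , _) = ob-iso-refl X γ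

  fromElement-cong : ∀ {Γ} (γ : Env Γ) {X} {u v : 𝟏 ⇒ X} →
    u ≈ v → fromElement γ u ≈ fromElement γ v
  fromElement-cong {∅}         _       e = e
  fromElement-cong {_ ▷Ob}     (γ , _) e = fromElement-cong γ e
  fromElement-cong {_ ▷ _ ⇒ _} (γ , _) e = fromElement-cong γ e

  invariant-fibre : ∀ {Γ} (γ : Env Γ) (U : Ob Γ) (φ : CatFormula (Γ ▷ 𝟙 Γ ⇒ U ▷Ob))
    {u v : 𝟏 ⇒ ⟦ U ⟧ₒ γ} {X Y : Obj} → u ≈ v → Iso X Y →
    ⟦ φ ⟧ ((γ , fromElement γ u) , X) → ⟦ φ ⟧ ((γ , fromElement γ v) , Y)
  invariant-fibre γ U φ e i = to (invariant φ (≅-arrow γ (fromElement-cong γ e) ,ₒ i))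

-- Structural collection in terms of projections

-- Structural collection with pullbacks of arrows replaced by the equations for
-- their projections: at C = 𝕊et M core, comparing the equality proofs inside
-- _^*ₐ_ and fibre is prohibitively expensive.
module FibrewiseCollection (C : Category ℓ) (L : FiniteLimits C) where
  open Category C hiding (id)
  open FiniteLimits L
  open Terminal terminal
  open Satisfaction C terminal
  open PullbackFunctor C L
  open Slice
  open _⇒/_

  private
    module PB {X Y Z : Obj} (f : X ⇒ Z) (g : Y ⇒ Z) = Pullback (pullback f g)

  -- On elements, `t` is (a , w) ↦ (a , v w), and `h` sends (a , w) to (b , w), where b is the first
  -- component of g (a , v w). As the projections of a pullback are jointly monic, the equations
  -- determine `h`.
  IsFibre : ∀ {U V W} (p : V ⇒ U) (A B : Slice C U) → dom (p ^* A) ⇒ dom (p ^* B) →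
    (v : W ⇒ V) → dom ((p ∘ v) ^* A) ⇒ dom ((p ∘ v) ^* B) → Set ℓ
  IsFibre p A B g v h = Σ[ t ∈ dom ((p ∘ v) ^* A) ⇒ dom (p ^* A) ]
    PB.p₁ (map A) p ∘ t ≈ PB.p₁ (map A) (p ∘ v) ×
    PB.p₂ (map A) p ∘ t ≈ v ∘ PB.p₂ (map A) (p ∘ v) ×
    PB.p₁ (map B) (p ∘ v) ∘ h ≈ PB.p₁ (map B) p ∘ (g ∘ t) ×
    PB.p₂ (map B) (p ∘ v) ∘ h ≈ PB.p₂ (map A) (p ∘ v)

  fibre-isFibre : ∀ {U V W} (p : V ⇒ U) (A B : Slice C U) (g : _⇒/_ C (p ^* A) (p ^* B))
    (v : W ⇒ V) → IsFibre p A B (arr g) v (fibre p A B g v)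
  fibre-isFibre p A B g v = _ , PB.p₁∘universal (map A) p , PB.p₂∘universal (map A) p ,
    Eq.trans (Eq.sym assoc)
      (Eq.trans (∘-resp-≈ (PB.p₁∘universal (map B) (p ∘ v)) Eq.refl)
      (Eq.trans assoc (∘-resp-≈ Eq.refl
      (Eq.trans (Eq.sym assoc)
      (Eq.trans (∘-resp-≈ (PB.p₁∘universal (map (p ^* B)) v) Eq.refl)
      (Eq.trans assoc (∘-resp-≈ Eq.refl (PB.p₁∘universal (map (p ^* A)) v)))))))) ,
    Eq.trans (Eq.sym assoc)
      (Eq.trans (∘-resp-≈ (PB.p₂∘universal (map B) (p ∘ v)) Eq.refl)
      (Eq.trans (Eq.sym assoc)
      (Eq.trans (∘-resp-≈ (PB.p₂∘universal (map (p ^* B)) v) Eq.refl)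
      (PB.p₂∘universal (map (p ^* A)) v))))

  Sets : Set ℓ
  Sets = ∀ {Γ} (γ : Env Γ) (U : Ob Γ) (φ : CatFormula (Γ ▷ 𝟙 Γ ⇒ U ▷Ob)) →
    let φ[_,_] = λ (u : 𝟏 ⇒ ⟦ U ⟧ₒ γ) X → ⟦ φ ⟧ ((γ , fromElement γ u) , X) in
    (∀ u → ∃[ X ] φ[ u , X ]) →
    ∃[ V ] Σ[ p ∈ V ⇒ ⟦ U ⟧ₒ γ ] IsRegularEpi C p ×
    (Σ[ A ∈ Slice C V ] ∀ (v : 𝟏 ⇒ V) → φ[ p ∘ v , dom (v ^* A) ])

  Functions : Set ℓ
  Functions = ∀ {Γ} (γ : Env Γ) (U : Ob Γ)
    (φ : CatFormula (Γ ▷ 𝟙 Γ ⇒ U ▷Ob ▷Ob ▷ wkₒ new ⇒ new)) (A B : Slice C (⟦ U ⟧ₒ γ)) →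
    let φ[_,_] = λ (u : 𝟏 ⇒ ⟦ U ⟧ₒ γ) (f : dom (u ^* A) ⇒ dom (u ^* B)) →
                   ⟦ φ ⟧ ((((γ , fromElement γ u) , dom (u ^* A)) , dom (u ^* B)) , f) in
    (∀ u → ∃[ f ] φ[ u , f ]) →
    ∃[ V ] Σ[ p ∈ V ⇒ ⟦ U ⟧ₒ γ ] IsRegularEpi C p ×
    (Σ[ g ∈ dom (p ^* A) ⇒ dom (p ^* B) ] PB.p₂ (map B) p ∘ g ≈ PB.p₂ (map A) p ×
      (∀ (v : 𝟏 ⇒ V) h → IsFibre p A B g v h → φ[ p ∘ v , h ]))

  Equalities : Set ℓ
  Equalities = ∀ U (A B : Slice C U) (f g : _⇒/_ C A B) →
    (∀ (u : 𝟏 ⇒ U) → arr f ∘ PB.p₁ (map A) u ≈ arr g ∘ PB.p₁ (map A) u) →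
    ∃[ V ] Σ[ p ∈ V ⇒ U ] IsRegularEpi C p ×
    arr f ∘ PB.p₁ (map A) p ≈ arr g ∘ PB.p₁ (map A) p

  structuralCollection : Sets → Functions → Equalities → StructuralCollection C L
  structuralCollection sets functions equalities = record
    { collection-of-sets       = sets
    ; collection-of-functions  = λ γ U φ A B hyp →
        let (V , p , epi , g₀ , tri , h) = functions γ U φ A B hyp
            g = record { arr = g₀ ; triangle = tri }
        in V , p , epi , g , λ v → h v _ (fibre-isFibre p A B g v)
    ; collection-of-equalities = λ U A B f g hyp →
        let (V , p , epi , e) = equalities U A B f g λ u →
              Eq.trans (Eq.sym (PB.p₁∘universal (map B) u))
                (Eq.trans (∘-resp-≈ Eq.refl (hyp u)) (PB.p₁∘universal (map B) u))
        in V , p , epi , PB.unique (map B) p _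
             (Eq.trans (PB.p₁∘universal (map B) p) e) (PB.p₂∘universal (map B) p)
    }

-- Translation of categorical formulas into set-theoretic ones

infixl 5 _,ₒ_ _,ₐ_

-- The positions at which the objects and the graphs of the arrows are stored, `base` being the one
-- of the terminal object. They are arbitrary, so a set may precede the sets over which it is typed,
-- as the collected graph does in `fullCode`.
data Coding (n : ℕ) : Ctx → Set where
  base : Fin n → Coding n ∅
  _,ₒ_ : ∀ {Γ} → Coding n Γ → Fin n → Coding n (Γ ▷Ob)
  _,ₐ_ : ∀ {Γ X Y} → Coding n Γ → Fin n → Coding n (Γ ▷ X ⇒ Y)

wk : ∀ {Γ} → Coding n Γ → Coding (1+ n) Γ
wk (base i) = base (fsuc i)
wk (c ,ₒ i) = wk c ,ₒ fsuc i
wk (c ,ₐ i) = wk c ,ₐ fsuc i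

wk* : ∀ {Γ} k → Coding n Γ → Coding (k + n) Γ
wk* 0      c = c
wk* (1+ k) c = wk (wk* k c)

obᶜ : ∀ {Γ} → Ob Γ → Coding n Γ → Fin n
obᶜ one     (base i) = i
obᶜ new     (_ ,ₒ i) = i
obᶜ (wkₒ X) (c ,ₒ _) = obᶜ X c
obᶜ (wkₐ X) (c ,ₐ _) = obᶜ X c

varᶜ : ∀ {Γ X Y} → ArrVar Γ X Y → Coding n Γ → Fin n
varᶜ new     (_ ,ₐ i) = i
varᶜ (wkₒ x) (c ,ₒ _) = varᶜ x c
varᶜ (wkₐ x) (c ,ₐ _) = varᶜ x c

function′ : (f a b : Fin n) → Formula n
function′ f a b =
  ∀∈′ f (∃∈′ (fsuc a) (∃∈′ (fsuc (fsuc b)) (opair′ 2F 1F 0F))) ∧′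
  ∀∈′ a (∃′ (opair∈′ 1F 0F (fsuc (fsuc f)) ∧′
    ∀′ (opair∈′ 2F 0F (fsuc (fsuc (fsuc f))) ⇒′ 1F ≈′ 0F)))

-- d = {(x , y) | f x = g y}
pullback′ : (d f g : Fin n) → Formula n
pullback′ d f g = ∀′ ((0F ∈′ fsuc d ⇒′ member) ∧′ (member ⇒′ 0F ∈′ fsuc d))
  where
  member = ∃′ (∃′ (opair′ 2F 1F 0F ∧′ ∃′
    (opair∈′ 2F 0F (fsuc (fsuc (fsuc (fsuc f)))) ∧′
     opair∈′ 1F 0F (fsuc (fsuc (fsuc (fsuc g)))))))

graph′ : ∀ {Γ X Y} → Arr Γ X Y → Coding n Γ → (x y : Fin n) → Formula n
graph′         (var f)  c x y = opair∈′ x y (varᶜ f c)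
graph′ {X = X} id′      c x y = x ∈′ obᶜ X c ∧′ x ≈′ y
graph′         (f ∘′ g) c x z =
  ∃′ (graph′ g (wk c) (fsuc x) 0F ∧′ graph′ f (wk c) 0F (fsuc z))
graph′ {Γ = Γ} {X = X} !′ c x y = x ∈′ obᶜ X c ∧′ y ∈′ obᶜ (𝟙 Γ) c

translate : ∀ {Γ} → CatFormula Γ → Coding n Γ → Formula n
-- One implication suffices: parallel graphs are single-valued and total on the same domain, so an
-- inclusion between them is an equality.
translate (f ≈′ g)     c = ∀′ (∀′ (graph′ f (wk* 2 c) 1F 0F ⇒′ graph′ g (wk* 2 c) 1F 0F))
translate ⊤′           c = ⊤′
translate ⊥′           c = ⊥′
translate (φ ∧′ ψ)     c = translate φ c ∧′ translate ψ c
translate (φ ∨′ ψ)     c = translate φ c ∨′ translate ψ c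
translate (φ ⇒′ ψ)     c = translate φ c ⇒′ translate ψ c
translate (∀Ob φ)      c = ∀′ (translate φ (wk c ,ₒ 0F))
translate (∃Ob φ)      c = ∃′ (translate φ (wk c ,ₒ 0F))
translate (∀Arr X Y φ) c =
  ∀′ (function′ 0F (obᶜ X (wk c)) (obᶜ Y (wk c)) ⇒′ translate φ (wk c ,ₐ 0F))
translate (∃Arr X Y φ) c =
  ∃′ (function′ 0F (obᶜ X (wk c)) (obᶜ Y (wk c)) ∧′ translate φ (wk c ,ₐ 0F))

-- Correctness of the translation

module _ (M : ∈-Structure ℓ) (core : CoreAxioms M) where
  open ∈-Structure M
  open CoreAxioms core
  open SetsAndFunctions M core
  open FiniteLimits (𝕊et-finiteLimits M core) using (terminal)
  open Terminal terminal using (𝟏)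
  open IsoInvariance (𝕊et M core) terminal using (Iso; invariant-fibre)
  module Cat = Satisfaction (𝕊et M core) terminal
  open Cat using (Env; ⟦_⟧ₒ; ⟦_⟧ᵥ; ⟦_⟧ₐ; ⟦!⟧; fromElement)

  infixl 5 _,ₒ_ _,ₐ_

  -- Representation is up to ≈, so that environments with ≈-equal objects and
  -- graphs share their representations and hence satisfy the same formulas.
  data Represents (ρ : Vec Carrier n) : ∀ {Γ} → Coding n Γ → Env Γ → Set ℓ where
    base : ∀ {i} → lookup ρ i ≈ 𝟏 → Represents ρ (base i) tt
    _,ₒ_ : ∀ {Γ} {c : Coding n Γ} {γ : Env Γ} {i A} →
           Represents ρ c γ → lookup ρ i ≈ A → Represents ρ (c ,ₒ i) (γ , A)
    _,ₐ_ : ∀ {Γ X Y} {c : Coding n Γ} {γ : Env Γ} {i} {f : ⟦ X ⟧ₒ γ ⟶ ⟦ Y ⟧ₒ γ} →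
           Represents ρ c γ → lookup ρ i ≈ graph f →
           Represents ρ {Γ ▷ X ⇒ Y} (c ,ₐ i) (γ , f)

  wk-rep : ∀ {Γ} {c : Coding n Γ} {γ : Env Γ} {ρ : Vec Carrier n} {x} →
    Represents ρ c γ → Represents (x ∷ ρ) (wk c) γ
  wk-rep (base e) = base e
  wk-rep (r ,ₒ e) = wk-rep r ,ₒ e
  wk-rep (r ,ₐ e) = wk-rep r ,ₐ e

  encode : ∀ {Γ} (γ : Env Γ) →
    ∃[ n ] Σ[ ρ ∈ Vec Carrier n ] Σ[ c ∈ Coding n Γ ] Represents ρ c γ
  encode {∅}         _       = 1 , 𝟏 ∷ [] , base 0F , base ≈.refl
  encode {_ ▷Ob}     (γ , A) = let (_ , ρ , c , r) = encode γ in
    _ , A ∷ ρ , wk c ,ₒ 0F , wk-rep r ,ₒ ≈.refl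
  encode {_ ▷ _ ⇒ _} (γ , f) = let (_ , ρ , c , r) = encode γ in
    _ , graph f ∷ ρ , wk c ,ₐ 0F , wk-rep r ,ₐ ≈.refl

  obᶜ-spec : ∀ {Γ} (X : Ob Γ) {c : Coding n Γ} {γ : Env Γ} {ρ : Vec Carrier n} →
    Represents ρ c γ → lookup ρ (obᶜ X c) ≈ ⟦ X ⟧ₒ γ
  obᶜ-spec one     (base e) = e
  obᶜ-spec new     (_ ,ₒ e) = e
  obᶜ-spec (wkₒ X) (r ,ₒ _) = obᶜ-spec X r
  obᶜ-spec (wkₐ X) (r ,ₐ _) = obᶜ-spec X r

  varᶜ-spec : ∀ {Γ X Y} (f : ArrVar Γ X Y) {c : Coding n Γ} {γ : Env Γ} {ρ : Vec Carrier n} →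
    Represents ρ c γ → lookup ρ (varᶜ f c) ≈ graph (⟦ f ⟧ᵥ γ)
  varᶜ-spec new     (_ ,ₐ e) = e
  varᶜ-spec (wkₒ f) (r ,ₒ _) = varᶜ-spec f r
  varᶜ-spec (wkₐ f) (r ,ₐ _) = varᶜ-spec f r

  graph-resp : ∀ {a b} (f : a ⟶ b) {x x′ y y′} →
    x ≈ x′ → y ≈ y′ → x ↦ y ∈ f → x′ ↦ y′ ∈ f
  graph-resp f e e′ = ∈-respˡ (⟨⟩-cong e e′)

  function′-intro : (ρ : Vec Carrier n) (i j k : Fin n) {a b : Carrier} (f : a ⟶ b) →
    lookup ρ i ≈ graph f → lookup ρ j ≈ a → lookup ρ k ≈ b → ⟦ function′ i j k ⟧ ρ
  function′-intro ρ i j k f ef ea eb =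
    ( λ p p∈ → let (x , x∈a , y , y∈b , e) = relation f p (∈-respʳ ef p∈) in
        x , ∈-respʳ (≈.sym ea) x∈a , y , ∈-respʳ (≈.sym eb) y∈b ,
        from (opair′-spec (y ∷ x ∷ p ∷ ρ) 2F 1F 0F) e) ,
    ( λ x x∈ → let (y , h , u) = functional f x (∈-respʳ ea x∈) in
        y , from (opair∈′-spec (y ∷ x ∷ ρ) 1F 0F (fsuc (fsuc i))) (∈-respʳ (≈.sym ef) h) ,
        λ y′ h′ → u (∈-respʳ ef (to (opair∈′-spec (y′ ∷ y ∷ x ∷ ρ) 2F 0F (fsuc (fsuc (fsuc i)))) h′)))

  function′-elim : (ρ : Vec Carrier n) (i j k : Fin n) {a b : Carrier} →
    lookup ρ j ≈ a → lookup ρ k ≈ b → ⟦ function′ i j k ⟧ ρ →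
    Σ[ f ∈ a ⟶ b ] lookup ρ i ≡ graph f
  function′-elim ρ i j k ea eb (rel , fun) = record
    { graph      = lookup ρ i
    ; relation   = λ p p∈ → let (x , x∈ , y , y∈ , h) = rel p p∈ in
        x , ∈-respʳ ea x∈ , y , ∈-respʳ eb y∈ , to (opair′-spec (y ∷ x ∷ p ∷ ρ) 2F 1F 0F) h
    ; functional = λ x x∈a → let (y , h , u) = fun x (∈-respʳ (≈.sym ea) x∈a) in
        y , to (opair∈′-spec (y ∷ x ∷ ρ) 1F 0F (fsuc (fsuc i))) h ,
        λ {y′} h′ → u y′ (from (opair∈′-spec (y′ ∷ y ∷ x ∷ ρ) 2F 0F (fsuc (fsuc (fsuc i)))) h′)
    } , ≡.refl

  ⟦!⟧-spec : ∀ {Γ} (γ : Env Γ) {a x y} →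
    x ↦ y ∈ ⟦!⟧ γ {a} ⇔ (x ∈ a × y ∈ ⟦ 𝟙 Γ ⟧ₒ γ)
  ⟦!⟧-spec {∅}         _       = !ᶠ-spec
  ⟦!⟧-spec {_ ▷Ob}     (γ , _) = ⟦!⟧-spec γ
  ⟦!⟧-spec {_ ▷ _ ⇒ _} (γ , _) = ⟦!⟧-spec γ

  graph′-spec : ∀ {Γ X Y} (f : Arr Γ X Y) {c : Coding n Γ} {γ : Env Γ} (ρ : Vec Carrier n)
    (x y : Fin n) → Represents ρ c γ →
    ⟦ graph′ f c x y ⟧ ρ ⇔ lookup ρ x ↦ lookup ρ y ∈ ⟦ f ⟧ₐ γ
  graph′-spec (var f) {c} ρ x y r = mk⇔
    (λ h → ∈-respʳ (varᶜ-spec f r) (to (opair∈′-spec ρ x y (varᶜ f c)) h))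
    (λ h → from (opair∈′-spec ρ x y (varᶜ f c)) (∈-respʳ (≈.sym (varᶜ-spec f r)) h))
  graph′-spec {X = X} id′ ρ x y r = mk⇔
    (λ (x∈ , e) → from id-spec (∈-respʳ (obᶜ-spec X r) x∈ , e))
    (λ h → let (x∈ , e) = to id-spec h in ∈-respʳ (≈.sym (obᶜ-spec X r)) x∈ , e)
  graph′-spec (f ∘′ g) {γ = γ} ρ x z r = mk⇔
    (λ (y , h , k) → from (∘-spec (⟦ f ⟧ₐ γ) (⟦ g ⟧ₐ γ))
      (y , to (graph′-spec g (y ∷ ρ) (fsuc x) 0F (wk-rep r)) h
         , to (graph′-spec f (y ∷ ρ) 0F (fsuc z) (wk-rep r)) k))
    (λ h → let (y , k , l) = to (∘-spec (⟦ f ⟧ₐ γ) (⟦ g ⟧ₐ γ)) h in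
      y , from (graph′-spec g (y ∷ ρ) (fsuc x) 0F (wk-rep r)) k
        , from (graph′-spec f (y ∷ ρ) 0F (fsuc z) (wk-rep r)) l)
  graph′-spec {Γ = Γ} {X = X} !′ {γ = γ} ρ x y r = mk⇔
    (λ (x∈ , y∈) → from (⟦!⟧-spec γ)
      (∈-respʳ (obᶜ-spec X r) x∈ , ∈-respʳ (obᶜ-spec (𝟙 Γ) r) y∈))
    (λ h → let (x∈ , y∈) = to (⟦!⟧-spec γ) h in
      ∈-respʳ (≈.sym (obᶜ-spec X r)) x∈ , ∈-respʳ (≈.sym (obᶜ-spec (𝟙 Γ) r)) y∈)

  arrow-intro : ∀ {Γ} (X Y : Ob Γ) {c : Coding n Γ} {γ : Env Γ} (ρ : Vec Carrier n) (i : Fin n) →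
    Represents ρ c γ → (f : ⟦ X ⟧ₒ γ ⟶ ⟦ Y ⟧ₒ γ) → lookup ρ i ≈ graph f →
    ⟦ function′ i (obᶜ X c) (obᶜ Y c) ⟧ ρ
  arrow-intro X Y {c} ρ i r f e =
    function′-intro ρ i (obᶜ X c) (obᶜ Y c) f e (obᶜ-spec X r) (obᶜ-spec Y r)

  arrow-elim : ∀ {Γ} (X Y : Ob Γ) {c : Coding n Γ} {γ : Env Γ} (ρ : Vec Carrier n) (i : Fin n) →
    Represents ρ c γ → ⟦ function′ i (obᶜ X c) (obᶜ Y c) ⟧ ρ →
    Σ[ f ∈ ⟦ X ⟧ₒ γ ⟶ ⟦ Y ⟧ₒ γ ] lookup ρ i ≡ graph f
  arrow-elim X Y {c} ρ i r =
    function′-elim ρ i (obᶜ X c) (obᶜ Y c) (obᶜ-spec X r) (obᶜ-spec Y r)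

  -- Away from equality and the arrow quantifiers the two semantics agree clause by clause. A set
  -- satisfying `function′` is itself the graph of the arrow rebuilt from it, so the extended
  -- environment is again represented.
  translate-spec : ∀ {Γ} (φ : CatFormula Γ) {c : Coding n Γ} {γ : Env Γ} (ρ : Vec Carrier n) →
    Represents ρ c γ → ⟦ translate φ c ⟧ ρ ⇔ Cat.⟦ φ ⟧ γ
  translate-spec (f ≈′ g) {γ = γ} ρ r = mk⇔
    (λ h → ≈ᶠ-intro {f = ⟦ f ⟧ₐ γ} {⟦ g ⟧ₐ γ} λ {x} {y} k →
      to (graph′-spec g (y ∷ x ∷ ρ) 1F 0F (wk-rep (wk-rep r)))
        (h x y (from (graph′-spec f (y ∷ x ∷ ρ) 1F 0F (wk-rep (wk-rep r))) k)))
    (λ e x y h → from (graph′-spec g (y ∷ x ∷ ρ) 1F 0F (wk-rep (wk-rep r)))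
      (∈-respʳ e (to (graph′-spec f (y ∷ x ∷ ρ) 1F 0F (wk-rep (wk-rep r))) h)))
  translate-spec ⊤′ ρ r = mk⇔ id id
  translate-spec ⊥′ ρ r = mk⇔ id id
  translate-spec (φ ∧′ ψ) ρ r = ×⇔ (translate-spec φ ρ r) (translate-spec ψ ρ r)
  translate-spec (φ ∨′ ψ) ρ r = ⊎⇔ (translate-spec φ ρ r) (translate-spec ψ ρ r)
  translate-spec (φ ⇒′ ψ) ρ r = mk⇔
    (λ h k → to (translate-spec ψ ρ r) (h (from (translate-spec φ ρ r) k)))
    (λ h k → from (translate-spec ψ ρ r) (h (to (translate-spec φ ρ r) k)))
  translate-spec (∀Ob φ) ρ r = mk⇔
    (λ h A → to (translate-spec φ (A ∷ ρ) (wk-rep r ,ₒ ≈.refl)) (h A))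
    (λ h A → from (translate-spec φ (A ∷ ρ) (wk-rep r ,ₒ ≈.refl)) (h A))
  translate-spec (∃Ob φ) ρ r = mk⇔
    (λ (A , h) → A , to (translate-spec φ (A ∷ ρ) (wk-rep r ,ₒ ≈.refl)) h)
    (λ (A , h) → A , from (translate-spec φ (A ∷ ρ) (wk-rep r ,ₒ ≈.refl)) h)
  translate-spec (∀Arr X Y φ) ρ r = mk⇔
    (λ h f → to (translate-spec φ (graph f ∷ ρ) (wk-rep r ,ₐ ≈.refl))
      (h (graph f) (arrow-intro X Y (graph f ∷ ρ) 0F (wk-rep r) f ≈.refl)))
    (λ h g k → let (f , e) = arrow-elim X Y (g ∷ ρ) 0F (wk-rep r) k in
      from (translate-spec φ (g ∷ ρ) (wk-rep r ,ₐ ≈.reflexive e)) (h f))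
  translate-spec (∃Arr X Y φ) ρ r = mk⇔
    (λ (g , k , h) → let (f , e) = arrow-elim X Y (g ∷ ρ) 0F (wk-rep r) k in
      f , to (translate-spec φ (g ∷ ρ) (wk-rep r ,ₐ ≈.reflexive e)) h)
    (λ (f , h) → graph f
      , arrow-intro X Y (graph f ∷ ρ) 0F (wk-rep r) f ≈.refl
      , from (translate-spec φ (graph f ∷ ρ) (wk-rep r ,ₐ ≈.refl)) h)

  -- Surjections are regular epimorphisms, bijections are isomorphisms

  Surjective : ∀ {a b} → a ⟶ b → Set ℓ
  Surjective {a} {b} f = ∀ {y} → y ∈ b → ∃[ x ] x ↦ y ∈ f

  module _ {a b : Carrier} (q : a ⟶ b) (surj : Surjective q) where

    private
      module Factor {c : Carrier} (h : a ⟶ c) (eq : h ∘ᶠ π₁ q q ≈ᶠ h ∘ᶠ π₂ q q) where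

        IsValue : Carrier → Carrier → Set ℓ
        IsValue y z = ∃[ x ] x ∈ a × x ↦ y ∈ q × x ↦ z ∈ h

        -- The pair (x , x′) is a point of the kernel pair of `q`, and there `eq` makes the values
        -- of `h` at x and x′ agree.
        single : ∀ {x x′ y z z′} →
          x ↦ y ∈ q → x′ ↦ y ∈ q → x ↦ z ∈ h → x′ ↦ z′ ∈ h → z ≈ z′
        single {x} {x′} k k′ l l′ =
          let p∈ = pb-intro q q k k′
              (x″ , m , l″) = to (∘-spec h (π₂ q q)) (∈-respʳ eq (from (∘-spec h (π₁ q q))
                (x , from (π₁-spec q q) (p∈ , x′ , ≈.refl) , l)))
              (_ , _ , e) = to (π₂-spec q q) m
          in single-valued h (graph-resp h (≈.sym (proj₂ (⟨⟩-injective e))) ≈.refl l″) l′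

        opaque
          factor-def : Σ[ k ∈ b ⟶ c ] (∀ {y z} → y ↦ z ∈ k ⇔ (y ∈ b × z ∈ c × IsValue y z))
          factor-def = define (∃∈′ 5F (opair∈′ 0F 2F 7F ∧′ opair∈′ 0F 1F 8F))
            (∃∈₀ (∧₀ opair∈₀ opair∈₀)) (a ∷ graph q ∷ graph h ∷ []) b c {R = IsValue}
            (λ y z → ∃∈⇔ λ x →
              let ρ = x ∷ z ∷ y ∷ ⟨ y , z ⟩ ∷ b ∷ c ∷ a ∷ graph q ∷ graph h ∷ [] in
              ×⇔ (opair∈′-spec ρ 0F 2F 7F) (opair∈′-spec ρ 0F 1F 8F))
            (λ y∈b → let (x , k) = surj y∈b
                         l       = value∈graph h (source q k)
                     in _ , target h l , x , source q k , k , l)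
            (λ _ _ _ (_ , _ , k , l) (_ , _ , k′ , l′) → single k k′ l l′)

        factor : b ⟶ c
        factor = proj₁ factor-def

        factor-intro : ∀ {x y z} → x ↦ y ∈ q → x ↦ z ∈ h → y ↦ z ∈ factor
        factor-intro k l = from (proj₂ factor-def)
          (target q k , target h l , _ , source q k , k , l)

    surjective⇒regularEpi : IsRegularEpi (𝕊et M core) q
    surjective⇒regularEpi = pb q q , π₁ q q , π₂ q q , record
      { equalizes  = Pullback.commute (FiniteLimits.pullback (𝕊et-finiteLimits M core) q q)
      ; coequalize = Factor.factor
      ; factors    = λ {_} {h} {eq} → ≈.sym (≈ᶠ-intro {f = h} {Factor.factor h eq ∘ᶠ q} λ l →
          let k = value∈graph q (source h l) in
          from (∘-spec (Factor.factor h eq) q) (_ , k , Factor.factor-intro h eq k l))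
      ; unique     = λ {_} {h} {eq} j e → ≈ᶠ-intro {f = j} {Factor.factor h eq} λ l →
          let (_ , k) = surj (source j l) in
          Factor.factor-intro h eq k (∈-respʳ e (from (∘-spec j q) (_ , k , l)))
      }

  module _ {a b : Carrier} (f : a ⟶ b)
    (inj : ∀ {x x′ y} → x ↦ y ∈ f → x′ ↦ y ∈ f → x ≈ x′) (surj : Surjective f) where

    private
      opaque
        inverse : Σ[ g ∈ b ⟶ a ] (∀ {y x} → y ↦ x ∈ g ⇔ (y ∈ b × x ∈ a × x ↦ y ∈ f))
        inverse = define (opair∈′ 0F 1F 5F) opair∈₀ (graph f ∷ []) b a
          {R = λ y x → x ↦ y ∈ f}
          (λ y x → opair∈′-spec (x ∷ y ∷ ⟨ y , x ⟩ ∷ b ∷ a ∷ graph f ∷ []) 0F 1F 5F)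
          (λ y∈b → let (x , h) = surj y∈b in x , source f h , h)
          (λ _ _ _ → inj)

      g : b ⟶ a
      g = proj₁ inverse

      g-spec : ∀ {y x} → y ↦ x ∈ g ⇔ x ↦ y ∈ f
      g-spec {y} {x} = mk⇔
        (λ h → proj₂ (proj₂ (to (proj₂ inverse {y} {x}) h)))
        (λ h → from (proj₂ inverse {y} {x}) (target f h , source f h , h))

    bijection⇒iso : Iso a b
    bijection⇒iso = record
      { fwd  = f
      ; bwd  = g
      ; isoˡ = ≈ᶠ-intro {f = g ∘ᶠ f} {idᶠ} λ h → let (_ , k , l) = to (∘-spec g f) h in
          from id-spec (source f k , inj k (to g-spec l))
      ; isoʳ = ≈ᶠ-intro {f = f ∘ᶠ g} {idᶠ} λ h → let (_ , k , l) = to (∘-spec f g) h in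
          from id-spec (source g k , single-valued f (to g-spec k) l)
      }

  -- Global elements and members

  ∅∈𝟏ˢ : ∅ˢ ∈ 𝟏
  ∅∈𝟏ˢ = ∈-pair₁

  element : ∀ {a x} → x ∈ a → Σ[ u ∈ 𝟏 ⟶ a ] ∅ˢ ↦ x ∈ u
  element {a} {x} x∈a = proj₁ u , from (proj₂ u) (∅∈𝟏ˢ , x∈a , ≈.refl)
    where
    u : Σ[ u ∈ 𝟏 ⟶ a ] (∀ {w y} → w ↦ y ∈ u ⇔ (w ∈ 𝟏 × y ∈ a × y ≈ x))
    u = define (0F ≈′ 5F) ≈₀ (x ∷ []) 𝟏 a (λ _ _ → mk⇔ id id)
      (λ _ → x , x∈a , ≈.refl)
      (λ _ _ _ e e′ → ≈.trans e (≈.sym e′))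

  element-value : ∀ {a x w y} (u : 𝟏 ⟶ a) → ∅ˢ ↦ x ∈ u → w ↦ y ∈ u → x ≈ y
  element-value u h k =
    single-valued u h (graph-resp u (𝟏ˢ-unique (source u k) ∅∈𝟏ˢ) ≈.refl k)

  element-unique : ∀ {a x} (u v : 𝟏 ⟶ a) → ∅ˢ ↦ x ∈ u → ∅ˢ ↦ x ∈ v → u ≈ᶠ v
  element-unique u v h k = ≈ᶠ-intro {f = u} {v} λ l →
    graph-resp v (𝟏ˢ-unique ∅∈𝟏ˢ (source u l)) (element-value u h l) k

  -- For a variable Γ, `⟦ 𝟙 Γ ⟧ₒ γ` does not reduce to `𝟏`, so `u` and `fromElement γ u` are not
  -- arrows of one type. Their graphs are both sets and can be compared.
  fromElement-graph : ∀ {Γ} (γ : Env Γ) {a} (u : 𝟏 ⟶ a) → graph (fromElement γ u) ≡ graph u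
  fromElement-graph {∅}         _       u = ≡.refl
  fromElement-graph {_ ▷Ob}     (γ , _) u = fromElement-graph γ u
  fromElement-graph {_ ▷ _ ⇒ _} (γ , _) u = fromElement-graph γ u

  graphElement : ∀ {Γ} (γ : Env Γ) {a} (u : ⟦ 𝟙 Γ ⟧ₒ γ ⟶ a) →
    Σ[ v ∈ 𝟏 ⟶ a ] graph v ≡ graph u
  graphElement {∅}         _       u = u , ≡.refl
  graphElement {_ ▷Ob}     (γ , _) u = graphElement γ u
  graphElement {_ ▷ _ ⇒ _} (γ , _) u = graphElement γ u

  -- Collecting witnesses together with their indices

  -- total collects pairs (x , z) with R x z, so that the index x can be
  -- recovered by the Δ₀-definable map proj.
  record Collected (a : Carrier) (R : Carrier → Carrier → Set ℓ) : Set ℓ where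
    field
      total      : Carrier
      values     : Carrier
      proj       : total ⟶ a
      surjective : Surjective proj
      member     : ∀ {y} → y ∈ total →
        ∃[ x ] ∃[ z ] y ≈ ⟨ x , z ⟩ × (y ↦ x ∈ proj) × z ∈ values × R x z

  -- The variables of ψ are the value z, the index x, an unused y and the parameters.
  collect : MaterialCollection M → (ψ : Formula (3 + n)) (ρ : Vec Carrier n) (a : Carrier)
    {R : Carrier → Carrier → Set ℓ} →
    (∀ x y z → ⟦ ψ ⟧ (z ∷ x ∷ y ∷ ρ) ⇔ R x z) →
    (∀ x → x ∈ a → ∃[ z ] R x z) → Collected a R
  collect coll ψ ρ a {R} ψ-spec nonempty = record
    { total      = b
    -- From z ∈ ｛ x , z ｝ ∈ ⟨ x , z ⟩ ∈ b, two unions contain every second component. This bounds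
    -- the quantifier of `IsProj` and makes `proj` Δ₀-definable.
    ; values     = ⋃ (⋃ b)
    ; proj       = p
    ; surjective = λ {x} x∈a →
        let (y , y∈b , z , e , _) = proj₁ (proj₂ collected) x x∈a
            ye = to (opair-at y x z) e
        in y , from p-spec (y∈b , x∈a , z , second∈ y∈b ye , ye)
    ; member     = λ {y} y∈b →
        let (x , x∈a , z , e , h) = proj₂ (proj₂ collected) y y∈b
            ye = to (opair-at y x z) e
            z∈ = second∈ y∈b ye
        in x , z , ye , from p-spec (y∈b , x∈a , z , z∈ , ye) , z∈ , to (ψ-spec x y z) h
    }
    where
    opair-at : ∀ y x z → ⟦ opair′ 2F 1F 0F ⟧ (z ∷ x ∷ y ∷ ρ) ⇔ y ≈ ⟨ x , z ⟩
    opair-at y x z = opair′-spec (z ∷ x ∷ y ∷ ρ) 2F 1F 0F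

    -- The first clause of collection yields surjectivity of `proj`, the second one yields `member`.
    collected = coll (∃′ (opair′ 2F 1F 0F ∧′ ψ)) ρ a λ x x∈a →
      let (z , r) = nonempty x x∈a
      in ⟨ x , z ⟩ , z , from (opair-at _ x z) ≈.refl , from (ψ-spec x _ z) r

    b : Carrier
    b = proj₁ collected

    second∈ : ∀ {x y z} → y ∈ b → y ≈ ⟨ x , z ⟩ → z ∈ ⋃ (⋃ b)
    second∈ {x} {y} {z} y∈b e = from (⋃-spec _) (｛ x , z ｝ ,
      from (⋃-spec _) (y , y∈b , ∈-respʳ (≈.sym e) ∈-pair₂) , ∈-pair₂)

    IsProj : Carrier → Carrier → Set ℓ
    IsProj y x = ∃[ z ] z ∈ ⋃ (⋃ b) × y ≈ ⟨ x , z ⟩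

    opaque
      p-def : Σ[ p ∈ b ⟶ a ] (∀ {y x} → y ↦ x ∈ p ⇔ (y ∈ b × x ∈ a × IsProj y x))
      p-def = define (∃∈′ 5F (opair′ 2F 1F 0F)) (∃∈₀ opair₀) (⋃ (⋃ b) ∷ []) b a {R = IsProj}
        (λ y x → ∃∈⇔ λ z →
          opair′-spec (z ∷ x ∷ y ∷ ⟨ y , x ⟩ ∷ b ∷ a ∷ ⋃ (⋃ b) ∷ []) 2F 1F 0F)
        (λ {y} y∈b →
          let (x , x∈a , z , e , _) = proj₂ (proj₂ collected) y y∈b
              ye = to (opair-at y x z) e
          in x , x∈a , z , second∈ y∈b ye , ye)
        (λ _ _ _ (_ , _ , e) (_ , _ , e′) → proj₁ (⟨⟩-injective (≈.trans (≈.sym e) e′)))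

    p : b ⟶ a
    p = proj₁ p-def

    p-spec : ∀ {y x} → y ↦ x ∈ p ⇔ (y ∈ b × x ∈ a × IsProj y x)
    p-spec = proj₂ p-def

  -- The family of the collected sets

  module TotalSpace {a : Carrier} {R : Carrier → Carrier → Set ℓ} (S : Collected a R) where
    open Collected S

    private
      IsPoint : Carrier → Set ℓ
      IsPoint p = ∃[ y ] y ∈ total × ∃[ w ] w ∈ ⋃ values × ∃[ z ] z ∈ values × ∃[ x ] x ∈ a ×
        p ≈ ⟨ y , w ⟩ × y ≈ ⟨ x , z ⟩ × w ∈ z

      pointφ : Formula 5
      pointφ = ∃∈′ 1F (∃∈′ 3F (∃∈′ 5F (∃∈′ 7F
        (opair′ 4F 3F 2F ∧′ opair′ 3F 0F 1F ∧′ 2F ∈′ 1F))))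

      pointφ-spec : ∀ p → ⟦ pointφ ⟧ (p ∷ total ∷ ⋃ values ∷ values ∷ a ∷ []) ⇔ IsPoint p
      pointφ-spec p = ∃∈⇔ λ y → ∃∈⇔ λ w → ∃∈⇔ λ z → ∃∈⇔ λ x →
        let ρ = x ∷ z ∷ w ∷ y ∷ p ∷ total ∷ ⋃ values ∷ values ∷ a ∷ [] in
        ×⇔ (opair′-spec ρ 4F 3F 2F) (×⇔ (opair′-spec ρ 3F 0F 1F) (mk⇔ id id))

    opaque
      space-def : ∃[ s ] ∀ p → p ∈ s ⇔
        (p ∈ total ×ˢ ⋃ values × ⟦ pointφ ⟧ (p ∷ total ∷ ⋃ values ∷ values ∷ a ∷ []))
      space-def = Δ₀-separation pointφ
        (∃∈₀ (∃∈₀ (∃∈₀ (∃∈₀ (∧₀ opair₀ (∧₀ opair₀ ∈₀))))))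
        (total ∷ ⋃ values ∷ values ∷ a ∷ []) (total ×ˢ ⋃ values)

    space : Carrier
    space = proj₁ space-def

    space-elim : ∀ {p} → p ∈ space →
      ∃[ y ] ∃[ w ] ∃[ x ] ∃[ z ] p ≈ ⟨ y , w ⟩ × y ≈ ⟨ x , z ⟩ × w ∈ z × y ∈ total × w ∈ ⋃ values
    space-elim {p} p∈ =
      let (y , y∈ , w , w∈ , z , _ , x , _ , e , e′ , w∈z) =
            to (pointφ-spec p) (proj₂ (to (proj₂ space-def p) p∈))
      in y , w , x , z , e , e′ , w∈z , y∈ , w∈

    -- The given `z` is not known to lie in `values`. But `member` splits y into a pair whose second
    -- component does, and injectivity of pairs identifies that component with `z`.
    space-intro : ∀ {x y z w} → y ∈ total → y ≈ ⟨ x , z ⟩ → w ∈ z → ⟨ y , w ⟩ ∈ space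
    space-intro {w = w} y∈ e w∈z =
      let (x′ , z′ , e′ , h , z′∈ , _) = member y∈
          w∈z′ = ∈-respʳ (proj₂ (⟨⟩-injective (≈.trans (≈.sym e) e′))) w∈z
          w∈   = from (⋃-spec values) (z′ , z′∈ , w∈z′)
      in from (proj₂ space-def _)
        ( from ×ˢ-spec (_ , y∈ , _ , w∈ , ≈.refl)
        , from (pointφ-spec _)
            (_ , y∈ , _ , w∈ , z′ , z′∈ , x′ , target proj h , ≈.refl , e′ , w∈z′))

    private
      IsBase : Carrier → Carrier → Set ℓ
      IsBase p y = ∃[ w ] w ∈ ⋃ values × p ≈ ⟨ y , w ⟩

    opaque
      fst-def : Σ[ f ∈ space ⟶ total ]
        (∀ {p y} → p ↦ y ∈ f ⇔ (p ∈ space × y ∈ total × IsBase p y))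
      fst-def = define (∃∈′ 5F (opair′ 2F 1F 0F)) (∃∈₀ opair₀) (⋃ values ∷ []) space total
        {R = IsBase}
        (λ p y → ∃∈⇔ λ w →
          opair′-spec (w ∷ y ∷ p ∷ ⟨ p , y ⟩ ∷ space ∷ total ∷ ⋃ values ∷ []) 2F 1F 0F)
        (λ p∈ → let (y , w , _ , _ , e , _ , _ , y∈ , w∈) = space-elim p∈ in
          y , y∈ , w , w∈ , e)
        (λ _ _ _ (_ , _ , e) (_ , _ , e′) → proj₁ (⟨⟩-injective (≈.trans (≈.sym e) e′)))

    fst : space ⟶ total
    fst = proj₁ fst-def

    module _ {x y z : Carrier} (v : 𝟏 ⟶ total) (v∅ : ∅ˢ ↦ y ∈ v) (y≈ : y ≈ ⟨ x , z ⟩) where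

      private
        -- A member of `pb fst v` pairs a point of `space` with a member of 1, so w enters the fibre
        -- as ((y , w) , ∅). The quantified p makes the inner pair available to a Δ₀ formula.
        IsInclusion : Carrier → Carrier → Set ℓ
        IsInclusion w q = ∃[ p ] p ∈ space × p ≈ ⟨ y , w ⟩ × q ≈ ⟨ p , ∅ˢ ⟩

        point∈ : ∀ {w} → w ∈ z → ⟨ y , w ⟩ ∈ space
        point∈ = space-intro (target v v∅) y≈

        in-fibre : ∀ {w} → w ∈ z → ⟨ ⟨ y , w ⟩ , ∅ˢ ⟩ ∈ pb fst v
        in-fibre w∈z =
          let p∈ = point∈ w∈z
              (y′ , w′ , _ , _ , e , _ , _ , _ , w′∈) = space-elim p∈
              w∈ = ∈-respˡ (≈.sym (proj₂ (⟨⟩-injective e))) w′∈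
          in pb-intro fst v
               (from (proj₂ fst-def) (p∈ , target v v∅ , _ , w∈ , ≈.refl)) v∅

        inclusion : Σ[ i ∈ z ⟶ pb fst v ]
          (∀ {w q} → w ↦ q ∈ i ⇔ (w ∈ z × q ∈ pb fst v × IsInclusion w q))
        inclusion = define (∃∈′ 5F (opair′ 0F 7F 2F ∧′ opair′ 1F 0F 8F))
          (∃∈₀ (∧₀ opair₀ opair₀)) (space ∷ y ∷ ∅ˢ ∷ []) z (pb fst v) {R = IsInclusion}
          (λ w q → ∃∈⇔ λ p →
            let ρ = p ∷ q ∷ w ∷ ⟨ w , q ⟩ ∷ z ∷ pb fst v ∷ space ∷ y ∷ ∅ˢ ∷ [] in
            ×⇔ (opair′-spec ρ 0F 7F 2F) (opair′-spec ρ 1F 0F 8F))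
          (λ w∈z → _ , in-fibre w∈z , _ , point∈ w∈z , ≈.refl , ≈.refl)
          (λ _ _ _ (_ , _ , e , d) (_ , _ , e′ , d′) →
            ≈.trans d (≈.trans (⟨⟩-cong (≈.trans e (≈.sym e′)) ≈.refl) (≈.sym d′)))

      fibre-iso : Iso z (pb fst v)
      fibre-iso = bijection⇒iso (proj₁ inclusion)
        (λ h k →
          let (_ , _ , _ , _ , e , d)    = to (proj₂ inclusion) h
              (_ , _ , _ , _ , e′ , d′) = to (proj₂ inclusion) k
              p≈p′ = proj₁ (⟨⟩-injective (≈.trans (≈.sym d) d′))
          in proj₂ (⟨⟩-injective (≈.trans (≈.sym e) (≈.trans p≈p′ e′))))
        (λ {q} q∈ →
          let (p , t , d , y′ , h , k) = to (pb-spec fst v) q∈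
              (p∈ , _ , w , _ , e) = to (proj₂ fst-def) h
              (y″ , w″ , x″ , z″ , e″ , e‴ , w″∈z″ , _) = space-elim p∈
              (yy , ww) = ⟨⟩-injective (≈.trans (≈.sym e) e″)
              y≈y′ = element-value v v∅ k
              z≈   = proj₂ (⟨⟩-injective
                (≈.trans (≈.sym e‴) (≈.trans (≈.sym yy) (≈.trans (≈.sym y≈y′) y≈))))
              w∈z  = ∈-respˡ (≈.sym ww) (∈-respʳ z≈ w″∈z″)
          in w , from (proj₂ inclusion) (w∈z , q∈ , p , p∈
               , ≈.trans e (⟨⟩-cong (≈.sym y≈y′) ≈.refl)
               , ≈.trans d (⟨⟩-cong ≈.refl (𝟏ˢ-unique (source v k) ∅∈𝟏ˢ))))

  -- Collection of sets

  module _ (coll : MaterialCollection M) where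

    module _ {Γ} (γ : Env Γ) (U : Ob Γ) (φ : CatFormula (Γ ▷ 𝟙 Γ ⇒ U ▷Ob)) where

      private
        U₀ : Carrier
        U₀ = ⟦ U ⟧ₒ γ

        φ[_,_] : 𝟏 ⟶ U₀ → Carrier → Set ℓ
        φ[ u , X ] = Cat.⟦ φ ⟧ ((γ , fromElement γ u) , X)

        R : Carrier → Carrier → Set ℓ
        R x X = Σ[ u ∈ 𝟏 ⟶ U₀ ] ∅ˢ ↦ x ∈ u × φ[ u , X ]

        size : ℕ
        size = proj₁ (encode γ)

        ρ : Vec Carrier size
        ρ = proj₁ (proj₂ (encode γ))

        c : Coding size Γ
        c = proj₁ (proj₂ (proj₂ (encode γ)))

        -- The code is weakened past five sets: the bound graph of u, then X, x, the y of `collect`,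
        -- and ∅ˢ. The latter is a parameter because the value of u is found at ∅ˢ.
        ψ : Formula (3 + 1+ size)
        ψ = ∃′ (function′ 0F (obᶜ (𝟙 Γ) (wk* 5 c)) (obᶜ U (wk* 5 c)) ∧′
          opair∈′ 4F 2F 0F ∧′ translate φ (wk* 5 c ,ₐ 0F ,ₒ 1F))

        ψ-spec : ∀ x y X → ⟦ ψ ⟧ (X ∷ x ∷ y ∷ ∅ˢ ∷ ρ) ⇔ R x X
        ψ-spec x y X = mk⇔
          (λ (g , h , k , l) →
            let ρ′ = g ∷ X ∷ x ∷ y ∷ ∅ˢ ∷ ρ
                (u′ , e) = arrow-elim (𝟙 Γ) U ρ′ 0F rep h
                (u , e′) = graphElement γ u′
                e″ = ≡.trans e (≡.sym e′)
            in u , ∈-respʳ (≈.reflexive e″) (to (opair∈′-spec ρ′ 4F 2F 0F) k)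
                 , to (translate-spec φ ρ′ (rep ,ₐ
                     ≈.reflexive (≡.trans e″ (≡.sym (fromElement-graph γ u))) ,ₒ ≈.refl)) l)
          (λ (u , k , l) →
            let ρ′ = graph u ∷ X ∷ x ∷ y ∷ ∅ˢ ∷ ρ
                e  = ≈.reflexive (≡.sym (fromElement-graph γ u))
            in graph u
             , arrow-intro (𝟙 Γ) U ρ′ 0F rep (fromElement γ u) e
             , from (opair∈′-spec ρ′ 4F 2F 0F) k
             , from (translate-spec φ ρ′ (rep ,ₐ e ,ₒ ≈.refl)) l)
          where
          rep : ∀ {g} → Represents (g ∷ X ∷ x ∷ y ∷ ∅ˢ ∷ ρ) (wk* 5 c) γ
          rep = wk-rep (wk-rep (wk-rep (wk-rep (wk-rep (proj₂ (proj₂ (proj₂ (encode γ))))))))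

      module _ (hyp : ∀ u → ∃[ X ] φ[ u , X ]) where

        private
          opaque
            S : Collected U₀ R
            S = collect coll ψ (∅ˢ ∷ ρ) U₀ {R} ψ-spec λ x x∈ →
              let (u , h) = element x∈
                  (X , r) = hyp u
              in X , u , h , r

          open Collected S
          open TotalSpace S

          -- The point y of `total` picked by `v` was collected along with an arrow `u`. This `u`
          -- equals `proj ∘ᶠ v`, since both send ∅ˢ to the first component of y, and the second
          -- component of y is isomorphic to the fibre.
          over : ∀ (v : 𝟏 ⟶ total) → φ[ proj ∘ᶠ v , pb fst v ]
          over v =
            let h = value∈graph v ∅∈𝟏ˢ
                (x , X , e , k , _ , u , l , r) = member (target v h)
                pv≈u = element-unique u (proj ∘ᶠ v) l (from (∘-spec proj v) (_ , h , k))
            in invariant-fibre γ U φ {u} {proj ∘ᶠ v} pv≈u (fibre-iso v h e) r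

        collection-of-sets :
          ∃[ V ] Σ[ p ∈ V ⟶ U₀ ] IsRegularEpi (𝕊et M core) p ×
          (Σ[ A ∈ Slice (𝕊et M core) V ] ∀ (v : 𝟏 ⟶ V) → φ[ p ∘ᶠ v , pb (Slice.map A) v ])
        collection-of-sets =
          total , proj , surjective⇒regularEpi proj surjective , slice fst , over

  -- Fibres on elements and collection of equalities

  open Slice using (dom) renaming (map to ⟪_⟫)
  open _⇒/_ using (arr)
  open FibrewiseCollection (𝕊et M core) (𝕊et-finiteLimits M core)

  module _ {a b c : Carrier} (f : a ⟶ c) (g : b ⟶ c) where

    π₁-value : ∀ {x y p x′} → p ≈ ⟨ x , y ⟩ → p ↦ x′ ∈ π₁ f g → x ≈ x′
    π₁-value e h = let (_ , _ , e′) = to (π₁-spec f g) h in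
      proj₁ (⟨⟩-injective (≈.trans (≈.sym e) e′))

    π₂-value : ∀ {x y p y′} → p ≈ ⟨ x , y ⟩ → p ↦ y′ ∈ π₂ f g → y ≈ y′
    π₂-value e h = let (_ , _ , e′) = to (π₂-spec f g) h in
      proj₂ (⟨⟩-injective (≈.trans (≈.sym e) e′))

  module _ {a b u v w : Carrier} {α : a ⟶ u} {β : b ⟶ u} {p : v ⟶ u} {i : w ⟶ v}
    {g : pb α p ⟶ pb β p} {h : pb α (p ∘ᶠ i) ⟶ pb β (p ∘ᶠ i)} {t : pb α (p ∘ᶠ i) ⟶ pb α p}
    (t₁ : π₁ α p ∘ᶠ t ≈ᶠ π₁ α (p ∘ᶠ i))
    (t₂ : π₂ α p ∘ᶠ t ≈ᶠ i ∘ᶠ π₂ α (p ∘ᶠ i))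
    (h₁ : π₁ β (p ∘ᶠ i) ∘ᶠ h ≈ᶠ π₁ β p ∘ᶠ (g ∘ᶠ t))
    (h₂ : π₂ β (p ∘ᶠ i) ∘ᶠ h ≈ᶠ π₂ α (p ∘ᶠ i)) where

    private
      q : w ⟶ u
      q = p ∘ᶠ i

    t-elim : ∀ {x y c} → ⟨ x , y ⟩ ↦ c ∈ t → ∃[ z ] c ≈ ⟨ x , z ⟩ × y ↦ z ∈ i
    t-elim k =
      let (x′ , z , e , _) = to (pb-spec α p) (target t k)
          l₁ = ∈-respʳ t₁ (from (∘-spec (π₁ α p) t)
                 (_ , k , from (π₁-spec α p) (target t k , z , e)))
          (y′ , m , n) = to (∘-spec i (π₂ α q)) (∈-respʳ t₂ (from (∘-spec (π₂ α p) t)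
                 (_ , k , from (π₂-spec α p) (target t k , x′ , e))))
      in z , ≈.trans e (⟨⟩-cong (≈.sym (π₁-value α q ≈.refl l₁)) ≈.refl)
       , graph-resp i (≈.sym (π₂-value α q ≈.refl m)) ≈.refl n

    h-elim : ∀ {x y r} → ⟨ x , y ⟩ ↦ r ∈ h →
      ∃[ x′ ] r ≈ ⟨ x′ , y ⟩ × ∃[ c ] ∃[ d ] ⟨ x , y ⟩ ↦ c ∈ t × c ↦ d ∈ g × d ↦ x′ ∈ π₁ β p
    h-elim k =
      let (x′ , y′ , e , _) = to (pb-spec β q) (target h k)
          (d , l , n) = to (∘-spec (π₁ β p) (g ∘ᶠ t)) (∈-respʳ h₁ (from (∘-spec (π₁ β q) h)
            (_ , k , from (π₁-spec β q) (target h k , y′ , e))))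
          (c , l₁ , l₂) = to (∘-spec g t) l
          y≈ = π₂-value α q ≈.refl (∈-respʳ h₂ (from (∘-spec (π₂ β q) h)
            (_ , k , from (π₂-spec β q) (target h k , x′ , e))))
      in x′ , ≈.trans e (⟨⟩-cong ≈.refl (≈.sym y≈)) , c , d , l₁ , l₂ , n

    -- The equations of `IsFibre` read on elements. Collection of functions knows the fibres of the
    -- glued map only in this form, which is the hypothesis on `h` in `Lifts`.
    fibre-elim : ∀ {x y r} → ⟨ x , y ⟩ ↦ r ∈ h →
      ∃[ x′ ] ∃[ z ] ∃[ z′ ] r ≈ ⟨ x′ , y ⟩ × (y ↦ z ∈ i) × ⟨ x , z ⟩ ↦ ⟨ x′ , z′ ⟩ ∈ g
    fibre-elim k =
      let (x′ , e , c , d , l , m , n) = h-elim k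
          (z , e₁ , o)                 = t-elim l
          (_ , z′ , e₂)                = to (π₁-spec β p) n
      in x′ , z , z′ , e , o , graph-resp g e₁ e₂ m

  module _ {a b c x y z : Carrier} (α : a ⟶ c) (f g : a ⟶ b) (u : 𝟏 ⟶ c) where

    -- The point x appears in the fibre over its image y as ⟨ x , ∅ˢ ⟩, and there the two composites
    -- agree.
    agree-at : f ∘ᶠ π₁ α u ≈ᶠ g ∘ᶠ π₁ α u → ∅ˢ ↦ y ∈ u → x ↦ y ∈ α → x ↦ z ∈ f → x ↦ z ∈ g
    agree-at e u∅ m k = after (to (∘-spec g (π₁ α u) {⟨ x , ∅ˢ ⟩} {z})
      (∈-respʳ e (from (∘-spec f (π₁ α u) {⟨ x , ∅ˢ ⟩} {z}) (x , projects , k))))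
      where
      projects : ⟨ x , ∅ˢ ⟩ ↦ x ∈ π₁ α u
      projects = from (π₁-spec α u {⟨ x , ∅ˢ ⟩} {x}) (pb-intro α u m u∅ , ∅ˢ , ≈.refl)

      after : ∃[ x′ ] ⟨ x , ∅ˢ ⟩ ↦ x′ ∈ π₁ α u × x′ ↦ z ∈ g → x ↦ z ∈ g
      after (_ , r , l) = graph-resp g (≈.sym (π₁-value α u {x} {∅ˢ} ≈.refl r)) ≈.refl l

  agree : ∀ {a b c} (α : a ⟶ c) (f g : a ⟶ b) →
    (∀ (u : 𝟏 ⟶ c) → f ∘ᶠ π₁ α u ≈ᶠ g ∘ᶠ π₁ α u) → f ≈ᶠ g
  agree α f g hyp = ≈ᶠ-intro {f = f} {g} λ k →
    let m        = value∈graph α (source f k)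
        (u , u∅) = element (target α m)
    in agree-at α f g u (hyp u) u∅ m k

  equalities : Equalities
  equalities U A B f g hyp =
    U , idᶠ , surjective⇒regularEpi idᶠ (λ x∈ → _ , from id-spec (x∈ , ≈.refl)) ,
    Category.∘-resp-≈ (𝕊et M core) {g = arr f} {arr g} {π₁ ⟪ A ⟫ idᶠ} {π₁ ⟪ A ⟫ idᶠ}
      (agree ⟪ A ⟫ (arr f) (arr g) hyp) ≈.refl

  -- Collection of functions

  pullback′-spec : (ρ : Vec Carrier n) (d i j : Fin n) {a b c : Carrier} (f : a ⟶ c) (g : b ⟶ c) →
    lookup ρ i ≈ graph f → lookup ρ j ≈ graph g →
    ⟦ pullback′ d i j ⟧ ρ ⇔ lookup ρ d ≈ pb f g
  pullback′-spec ρ d i j f g ef eg = mk⇔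
    (λ h → extensionality _ _ λ p → mk⇔
      (λ p∈ → from (pb-spec f g) (to (member p) (proj₁ (h p) p∈)))
      (λ p∈ → proj₂ (h p) (from (member p) (to (pb-spec f g) p∈))))
    (λ e p →
      (λ p∈ → from (member p) (to (pb-spec f g) (∈-respʳ e p∈))) ,
      (λ m → ∈-respʳ (≈.sym e) (from (pb-spec f g) (to (member p) m))))
    where
    at : ∀ {a b} (f : a ⟶ b) (i : Fin n) (ρ′ : Vec Carrier (4 + n)) (x y : Fin (4 + n)) →
      lookup ρ′ (fsuc (fsuc (fsuc (fsuc i)))) ≈ graph f →
      ⟦ opair∈′ x y (fsuc (fsuc (fsuc (fsuc i)))) ⟧ ρ′ ⇔ lookup ρ′ x ↦ lookup ρ′ y ∈ f
    at f i ρ′ x y e = mk⇔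
      (λ h → ∈-respʳ e (to (opair∈′-spec ρ′ x y _) h))
      (λ h → from (opair∈′-spec ρ′ x y _) (∈-respʳ (≈.sym e) h))

    ∃⇔ : {P Q : Carrier → Set ℓ} → (∀ x → P x ⇔ Q x) → ∃ P ⇔ ∃ Q
    ∃⇔ e = mk⇔ (λ (x , h) → x , to (e x) h) (λ (x , h) → x , from (e x) h)

    member : ∀ p → ⟦ ∃′ (∃′ (opair′ 2F 1F 0F ∧′ ∃′
        (opair∈′ 2F 0F (fsuc (fsuc (fsuc (fsuc i)))) ∧′
         opair∈′ 1F 0F (fsuc (fsuc (fsuc (fsuc j))))))) ⟧ (p ∷ ρ) ⇔
      (∃[ x ] ∃[ y ] p ≈ ⟨ x , y ⟩ × ∃[ z ] x ↦ z ∈ f × y ↦ z ∈ g)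
    member p = ∃⇔ λ x → ∃⇔ λ y → ×⇔ (opair′-spec (y ∷ x ∷ p ∷ ρ) 2F 1F 0F)
      (∃⇔ λ z → let ρ′ = z ∷ y ∷ x ∷ p ∷ ρ in
        ×⇔ (at f i ρ′ 2F 0F ef) (at g j ρ′ 1F 0F eg))

  pb-cong : ∀ {a b c} (f : a ⟶ c) {g g′ : b ⟶ c} → g ≈ᶠ g′ → pb f g ≈ pb f g′
  pb-cong f {g} {g′} e = ⊆-antisym
    (λ p p∈ → let (x , y , d , z , k , l) = to (pb-spec f g) p∈ in
      from (pb-spec f g′) (x , y , d , z , k , ∈-respʳ e l))
    (λ p p∈ → let (x , y , d , z , k , l) = to (pb-spec f g′) p∈ in
      from (pb-spec f g) (x , y , d , z , k , ∈-respʳ (≈.sym e) l))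

  -- The sources are merely ≈-equal, so `≈ᶠ-intro` does not typecheck here; totality of `f` and
  -- single-valuedness of `g` again give the reverse inclusion.
  graph-≈ : ∀ {a a′ b b′} (f : a ⟶ b) (g : a′ ⟶ b′) → a′ ≈ a →
    (∀ {x y} → x ↦ y ∈ f → x ↦ y ∈ g) → graph f ≈ graph g
  graph-≈ f g e h = ⊆-antisym
    (λ p p∈ → let (_ , _ , _ , _ , d) = relation f p p∈ in
      ∈-respˡ (≈.sym d) (h (∈-respˡ d p∈)))
    (λ p p∈ → let (x , x∈ , y , _ , d) = relation g p p∈
                  k  = value∈graph f (∈-respʳ e x∈)
                  e′ = single-valued g (h k) (∈-respˡ d p∈)
              in ∈-respˡ (≈.trans (⟨⟩-cong ≈.refl e′) (≈.sym d)) k)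

  -- Unlike IsoInvariance.invariant, this compares environments whose arrows have
  -- different, merely ≈-equal, domains and codomains.
  same-code : ∀ {Γ} (φ : CatFormula Γ) {c : Coding n Γ} {γ γ′ : Env Γ} {ρ : Vec Carrier n} →
    Represents ρ c γ → Represents ρ c γ′ → Cat.⟦ φ ⟧ γ → Cat.⟦ φ ⟧ γ′
  same-code φ {ρ = ρ} r r′ h = to (translate-spec φ ρ r′) (from (translate-spec φ ρ r) h)

  module _ (coll : MaterialCollection M) {Γ} (γ : Env Γ) (U : Ob Γ)
    (φ : CatFormula (Γ ▷ 𝟙 Γ ⇒ U ▷Ob ▷Ob ▷ wkₒ new ⇒ new)) where

    private
      U₀ : Carrier
      U₀ = ⟦ U ⟧ₒ γ

      φ[_,_,_,_] : 𝟏 ⟶ U₀ → (X Y : Carrier) → X ⟶ Y → Set ℓ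
      φ[ u , X , Y , f ] = Cat.⟦ φ ⟧ ((((γ , fromElement γ u) , X) , Y) , f)

      size : ℕ
      size = proj₁ (encode γ)

      params : Vec Carrier size
      params = proj₁ (proj₂ (encode γ))

      c : Coding size Γ
      c = proj₁ (proj₂ (proj₂ (encode γ)))

      -- Ahead of the parameters stand Y, X, u, F, x, y, ∅ˢ and the graphs of α and β. F comes after
      -- X and Y because it is the collected value, free in `ψ`, whereas they are bound there.
      fullCode : Coding (9 + size) (Γ ▷ 𝟙 Γ ⇒ U ▷Ob ▷Ob ▷ wkₒ new ⇒ new)
      fullCode = wk* 9 c ,ₐ 2F ,ₒ 1F ,ₒ 0F ,ₐ 3F

      Lifts : ∀ {A₀ B₀ V} (α : A₀ ⟶ U₀) (β : B₀ ⟶ U₀) (p : V ⟶ U₀) →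
        pb α p ⟶ pb β p → Set ℓ
      Lifts {V = V} α β p g = ∀ (v : 𝟏 ⟶ V) (h : pb α (p ∘ᶠ v) ⟶ pb β (p ∘ᶠ v)) →
        (∀ {a w r} → ⟨ a , w ⟩ ↦ r ∈ h →
          ∃[ b ] ∃[ y ] ∃[ y′ ] r ≈ ⟨ b , w ⟩ × (w ↦ y ∈ v) × ⟨ a , y ⟩ ↦ ⟨ b , y′ ⟩ ∈ g) →
        φ[ p ∘ᶠ v , pb α (p ∘ᶠ v) , pb β (p ∘ᶠ v) , h ]

    module _ {A₀ B₀ : Carrier} (α : A₀ ⟶ U₀) (β : B₀ ⟶ U₀) where

      private
        R : Carrier → Carrier → Set ℓ
        R x F = Σ[ u ∈ 𝟏 ⟶ U₀ ] ∅ˢ ↦ x ∈ u ×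
          (Σ[ f ∈ pb α u ⟶ pb β u ] F ≈ graph f × φ[ u , pb α u , pb β u , f ])

        ρ : Vec Carrier (3 + size)
        ρ = ∅ˢ ∷ graph α ∷ graph β ∷ params

        rep : ∀ {Y X e F x y} → Represents (Y ∷ X ∷ e ∷ F ∷ x ∷ y ∷ ρ) (wk* 9 c) γ
        rep = wk-rep (wk-rep (wk-rep (wk-rep (wk-rep (wk-rep (wk-rep (wk-rep (wk-rep
          (proj₂ (proj₂ (proj₂ (encode γ))))))))))))

        fullRep : ∀ {Y X F x y} (u : 𝟏 ⟶ U₀) (f : pb α u ⟶ pb β u) →
          X ≈ pb α u → Y ≈ pb β u → F ≈ graph f →
          ∀ {e} → e ≡ graph u →
          Represents (Y ∷ X ∷ e ∷ F ∷ x ∷ y ∷ ρ) fullCode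
            ((((γ , fromElement γ u) , pb α u) , pb β u) , f)
        fullRep u f eX eY eF e = rep
          ,ₐ ≈.reflexive (≡.trans e (≡.sym (fromElement-graph γ u))) ,ₒ eX ,ₒ eY ,ₐ eF

        -- The values of the first quantifiers are u , pb α u and pb β u.
        ψ : Formula (6 + size)
        ψ = ∃′ (∃′ (∃′ (
          (function′ 2F (obᶜ (𝟙 Γ) (wk* 9 c)) (obᶜ U (wk* 9 c)) ∧′ opair∈′ 6F 4F 2F) ∧′
          (pullback′ 1F 7F 2F ∧′ pullback′ 0F 8F 2F) ∧′
          function′ 3F 1F 0F ∧′ translate φ fullCode)))

        ψ⇒R : ∀ x y F → ⟦ ψ ⟧ (F ∷ x ∷ y ∷ ρ) → R x F
        ψ⇒R x y F (g , X , Y , (h , k) , (hX , hY) , hF , l) =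
          let ρ′ = Y ∷ X ∷ g ∷ F ∷ x ∷ y ∷ ρ
              (u′ , e) = arrow-elim (𝟙 Γ) U ρ′ 2F rep h
              (u , e′) = graphElement γ u′
              eu = ≡.trans e (≡.sym e′)
              eX = to (pullback′-spec ρ′ 1F 7F 2F α u ≈.refl (≈.reflexive eu)) hX
              eY = to (pullback′-spec ρ′ 0F 8F 2F β u ≈.refl (≈.reflexive eu)) hY
              (f , eF) = function′-elim ρ′ 3F 1F 0F eX eY hF
          in u , ∈-respʳ (≈.reflexive eu) (to (opair∈′-spec ρ′ 6F 4F 2F) k)
           , f , ≈.reflexive eF
           , to (translate-spec φ ρ′ (fullRep u f eX eY (≈.reflexive eF) eu)) l

        R⇒ψ : ∀ x y F → R x F → ⟦ ψ ⟧ (F ∷ x ∷ y ∷ ρ)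
        R⇒ψ x y F (u , k , f , eF , l) =
          let ρ′ = pb β u ∷ pb α u ∷ graph u ∷ F ∷ x ∷ y ∷ ρ in
          graph u , pb α u , pb β u ,
          ( arrow-intro (𝟙 Γ) U ρ′ 2F rep (fromElement γ u)
              (≈.reflexive (≡.sym (fromElement-graph γ u)))
          , from (opair∈′-spec ρ′ 6F 4F 2F) k) ,
          ( from (pullback′-spec ρ′ 1F 7F 2F α u ≈.refl ≈.refl) ≈.refl
          , from (pullback′-spec ρ′ 0F 8F 2F β u ≈.refl ≈.refl) ≈.refl) ,
          function′-intro ρ′ 3F 1F 0F f eF ≈.refl ≈.refl ,
          from (translate-spec φ ρ′ (fullRep u f ≈.refl ≈.refl eF ≡.refl)) l

        transfer : ∀ (u u′ : 𝟏 ⟶ U₀) (f : pb α u ⟶ pb β u) (f′ : pb α u′ ⟶ pb β u′) →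
          u ≈ᶠ u′ → graph f ≈ graph f′ →
          φ[ u , pb α u , pb β u , f ] → φ[ u′ , pb α u′ , pb β u′ , f′ ]
        transfer u u′ f f′ e ef = same-code φ {c = fullCode}
          -- The two `∅ˢ` before `ρ` are fillers for the places of x and y, which `fullCode` does
          -- not address.
          {ρ = pb β u ∷ pb α u ∷ graph u ∷ graph f ∷ ∅ˢ ∷ ∅ˢ ∷ ρ}
          (fullRep u f ≈.refl ≈.refl ≈.refl ≡.refl)
          (rep ,ₐ ≈.trans e (≈.reflexive (≡.sym (fromElement-graph γ u′)))
            ,ₒ pb-cong α e ,ₒ pb-cong β e ,ₐ ef)

      module _ (hyp : ∀ (u : 𝟏 ⟶ U₀) →
        Σ[ f ∈ pb α u ⟶ pb β u ] φ[ u , pb α u , pb β u , f ]) where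

        private
          opaque
            S : Collected U₀ R
            S = collect coll ψ ρ U₀ {R} (λ x y F → mk⇔ (ψ⇒R x y F) (R⇒ψ x y F)) λ x x∈ →
              let (u , h) = element x∈
                  (f , r) = hyp u
              in graph f , u , h , f , ≈.refl , r

          open Collected S

          V : Carrier
          V = total

          -- Fibres over an element consist of pairs (a , ∅). The products with 1 provide a set over
          -- which a Δ₀ formula can quantify to name such pairs.
          Related : Carrier → Carrier → Carrier → Set ℓ
          Related F a b = ∃[ m ] m ∈ A₀ ×ˢ 𝟏 × ∃[ n ] n ∈ B₀ ×ˢ 𝟏 ×
            m ≈ ⟨ a , ∅ˢ ⟩ × n ≈ ⟨ b , ∅ˢ ⟩ × ⟨ m , n ⟩ ∈ F

          -- The point y = (x , F) carries its own map of fibres, the function with graph F. The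
          -- lift is this function over y, with the tag ∅ of its arguments and values replaced by y.
          IsLift : Carrier → Carrier → Set ℓ
          IsLift q r = ∃[ y ] y ∈ V × ∃[ a ] a ∈ A₀ × ∃[ b ] b ∈ B₀ ×
            q ≈ ⟨ a , y ⟩ × r ≈ ⟨ b , y ⟩ ×
            ∃[ x ] x ∈ U₀ × ∃[ F ] F ∈ values × y ≈ ⟨ x , F ⟩ × Related F a b

          -- The variables are F, x, b, a, y, r, q, ⟨ q , r ⟩, P, Q and then `liftParams`; with the
          -- shifts by m and n this gives 15, 17 and 19 for `A₀ ×ˢ 𝟏`, `B₀ ×ˢ 𝟏` and `∅ˢ`.
          relatedφ : Formula 18
          relatedφ = ∃∈′ (# 15) (∃∈′ (# 17)
            (opair′ 1F 5F (# 19) ∧′ opair′ 0F 4F (# 19) ∧′ opair∈′ 1F 0F 2F))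

          liftφ : Formula 13
          liftφ = ∃∈′ 5F (∃∈′ 7F (∃∈′ 9F (opair′ 4F 1F 2F ∧′ opair′ 3F 0F 2F ∧′
            ∃∈′ (# 11) (∃∈′ (# 13) (opair′ 4F 1F 0F ∧′ relatedφ)))))

          P Q : Carrier
          P = pb α proj
          Q = pb β proj

          liftParams : Vec Carrier 8
          liftParams = V ∷ A₀ ∷ B₀ ∷ U₀ ∷ values ∷ A₀ ×ˢ 𝟏 ∷ B₀ ×ˢ 𝟏 ∷ ∅ˢ ∷ []

          liftφ-spec : ∀ q r → ⟦ liftφ ⟧ (r ∷ q ∷ ⟨ q , r ⟩ ∷ P ∷ Q ∷ liftParams) ⇔ IsLift q r
          liftφ-spec q r = ∃∈⇔ λ y → ∃∈⇔ λ a → ∃∈⇔ λ b →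
            let ρ₁ = b ∷ a ∷ y ∷ r ∷ q ∷ ⟨ q , r ⟩ ∷ P ∷ Q ∷ liftParams in
            ×⇔ (opair′-spec ρ₁ 4F 1F 2F) (×⇔ (opair′-spec ρ₁ 3F 0F 2F)
              (∃∈⇔ λ x → ∃∈⇔ λ F → ×⇔ (opair′-spec (F ∷ x ∷ ρ₁) 4F 1F 0F)
                (∃∈⇔ λ m → ∃∈⇔ λ n → let ρ₂ = n ∷ m ∷ F ∷ x ∷ ρ₁ in
                  ×⇔ (opair′-spec ρ₂ 1F 5F (# 19)) (×⇔ (opair′-spec ρ₂ 0F 4F (# 19))
                     (opair∈′-spec ρ₂ 1F 0F 2F)))))

          Fibre : Carrier → Set ℓ
          Fibre y = ∃[ x ] ∃[ F ] y ≈ ⟨ x , F ⟩ × (y ↦ x ∈ proj) × F ∈ values × R x F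

          -- The value of F at (a , ∅) is a point of `pb β u`, so its first component b lies over
          -- the value of u, which is x. Hence (b , y) belongs to Q.
          fibre-value : ∀ {y a x} → Fibre y → a ↦ x ∈ α → y ↦ x ∈ proj →
            ∃[ F ] ∃[ b ] (b ↦ x ∈ β) × F ∈ values × y ≈ ⟨ x , F ⟩ × ⟨ ⟨ a , ∅ˢ ⟩ , ⟨ b , ∅ˢ ⟩ ⟩ ∈ F
          fibre-value (x , F , e , k , F∈ , u , h , f , eF , _) ha hy =
            let x≈ = single-valued proj hy k
                m∈ = pb-intro α u (graph-resp α ≈.refl x≈ ha) h
                n  = value∈graph f m∈
                (b , w , d , z , l , l′) = to (pb-spec β u) (target f n)
                z≈ = element-value u h l′
                w≈ = 𝟏ˢ-unique (source u l′) ∅∈𝟏ˢ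
            in F , b , graph-resp β ≈.refl (≈.trans (≈.sym z≈) (≈.sym x≈)) l , F∈
             , ≈.trans e (⟨⟩-cong (≈.sym x≈) ≈.refl)
             , ∈-respʳ (≈.sym eF) (graph-resp f ≈.refl (≈.trans d (⟨⟩-cong ≈.refl w≈)) n)

          fibre-single : ∀ {x F m n n′} → R x F → ⟨ m , n ⟩ ∈ F → ⟨ m , n′ ⟩ ∈ F → n ≈ n′
          fibre-single (_ , _ , f , e , _) h k = single-valued f (∈-respʳ e h) (∈-respʳ e k)

          lift-total : ∀ {q} → q ∈ P → ∃[ r ] r ∈ Q × IsLift q r
          lift-total q∈ =
            let (a , y , e , x , k , l) = to (pb-spec α proj) q∈
                (F , b , lb , F∈ , ye , h) = fibre-value (member (source proj l)) k l
            in ⟨ b , y ⟩ , pb-intro β proj lb l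
             , y , source proj l , a , source α k , b , source β lb , e , ≈.refl
             , x , target proj l , F , F∈ , ye
             , ⟨ a , ∅ˢ ⟩ , from ×ˢ-spec (a , source α k , ∅ˢ , ∅∈𝟏ˢ , ≈.refl)
             , ⟨ b , ∅ˢ ⟩ , from ×ˢ-spec (b , source β lb , ∅ˢ , ∅∈𝟏ˢ , ≈.refl)
             , ≈.refl , ≈.refl , h

          -- A lift brings its own a, y and F. Injectivity of pairs trades them for the given ones,
          -- so that two lifts of the same q are compared inside one single-valued graph.
          lift-at : ∀ {q r a y} → q ≈ ⟨ a , y ⟩ → IsLift q r → (d : Fibre y) →
            ∃[ b ] r ≈ ⟨ b , y ⟩ × ⟨ ⟨ a , ∅ˢ ⟩ , ⟨ b , ∅ˢ ⟩ ⟩ ∈ proj₁ (proj₂ d)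
          lift-at e (y′ , _ , a′ , _ , b , _ , e′ , er , x , _ , F , _ , ye ,
                     m , _ , n , _ , em , en , h) (_ , _ , d , _) =
            let (a≈ , y≈) = ⟨⟩-injective (≈.trans (≈.sym e′) e)
                (_ , F≈)  = ⟨⟩-injective (≈.trans (≈.sym ye) (≈.trans y≈ d))
            in b , ≈.trans er (⟨⟩-cong ≈.refl y≈)
             , ∈-respʳ F≈ (∈-respˡ (⟨⟩-cong (≈.trans em (⟨⟩-cong a≈ ≈.refl)) en) h)

          lift-single : ∀ {q r r′} → q ∈ P → IsLift q r → IsLift q r′ → r ≈ r′
          lift-single q∈ h h′ =
            let (a , y , e , x , k , l) = to (pb-spec α proj) q∈
                d = member (source proj l)
                (b , er , m)    = lift-at e h d
                (b′ , er′ , m′) = lift-at e h′ d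
                b≈ = proj₁ (⟨⟩-injective (fibre-single (proj₂ (proj₂ (proj₂ (proj₂ (proj₂ d))))) m m′))
            in ≈.trans er (≈.trans (⟨⟩-cong b≈ ≈.refl) (≈.sym er′))

          opaque
            lift-def : Σ[ g ∈ P ⟶ Q ] (∀ {q r} → q ↦ r ∈ g ⇔ (q ∈ P × r ∈ Q × IsLift q r))
            lift-def = define liftφ
              (∃∈₀ (∃∈₀ (∃∈₀ (∧₀ opair₀ (∧₀ opair₀ (∃∈₀ (∃∈₀ (∧₀ opair₀
                (∃∈₀ (∃∈₀ (∧₀ opair₀ (∧₀ opair₀ opair∈₀))))))))))))
              liftParams P Q {R = IsLift} liftφ-spec lift-total
              (λ q∈ _ _ → lift-single q∈)

        lift : P ⟶ Q
        lift = proj₁ lift-def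

        lift-triangle : π₂ β proj ∘ᶠ lift ≈ᶠ π₂ α proj
        lift-triangle = ≈ᶠ-intro {f = π₂ β proj ∘ᶠ lift} {π₂ α proj} λ h →
          let (r , k , l) = to (∘-spec (π₂ β proj) lift) h
              (q∈ , _ , y , _ , a , _ , b , _ , e , er , _) = to (proj₂ lift-def) k
              y≈ = π₂-value β proj er l
          in from (π₂-spec α proj) (q∈ , a , ≈.trans e (⟨⟩-cong ≈.refl y≈))

        module _ (v : 𝟏 ⟶ V) (h : pb α (proj ∘ᶠ v) ⟶ pb β (proj ∘ᶠ v))
          (h-elim : ∀ {a w r} → ⟨ a , w ⟩ ↦ r ∈ h →
            ∃[ b ] ∃[ y ] ∃[ y′ ] r ≈ ⟨ b , w ⟩ × (w ↦ y ∈ v) × ⟨ a , y ⟩ ↦ ⟨ b , y′ ⟩ ∈ lift)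
          where

          -- The gluing is undone here: `h` acts on (a , w) as `lift` acts on (a , y), that is, as F
          -- acts on (a , ∅), and w is ∅. So `h` is contained in F, and `graph-≈` turns this into
          -- equality.
          h-value : ∀ {y} → ∅ˢ ↦ y ∈ v → (d : Fibre y) →
            ∀ {q r} → q ↦ r ∈ h → ⟨ q , r ⟩ ∈ proj₁ (proj₂ d)
          h-value v∅ d k =
            let (a , w , e , _ , _ , l) = to (pb-spec α (proj ∘ᶠ v)) (source h k)
                (b , y′ , _ , er , vw , m) = h-elim (graph-resp h e ≈.refl k)
                y≈ = element-value v v∅ vw
                (_ , _ , lf) = to (proj₂ lift-def) m
                (b′ , eb , n) = lift-at (⟨⟩-cong ≈.refl (≈.sym y≈)) lf d
                w≈ = 𝟏ˢ-unique (source v vw) ∅∈𝟏ˢ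
            in ∈-respˡ (≈.sym (⟨⟩-cong (≈.trans e (⟨⟩-cong ≈.refl w≈))
                 (≈.trans er (⟨⟩-cong (proj₁ (⟨⟩-injective eb)) w≈)))) n

          over-at : ∀ {y} → ∅ˢ ↦ y ∈ v → Fibre y →
            φ[ proj ∘ᶠ v , pb α (proj ∘ᶠ v) , pb β (proj ∘ᶠ v) , h ]
          over-at v∅ d@(_ , _ , _ , k , _ , u , l , f , eF , r) =
            let u≈ = element-unique u (proj ∘ᶠ v) l (from (∘-spec proj v) (_ , v∅ , k))
            in transfer u (proj ∘ᶠ v) f h u≈
                 (≈.sym (graph-≈ h f (pb-cong α u≈)
                   λ m → ∈-respʳ eF (h-value v∅ d m))) r

          over : φ[ proj ∘ᶠ v , pb α (proj ∘ᶠ v) , pb β (proj ∘ᶠ v) , h ]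
          over = let v∅ = value∈graph v ∅∈𝟏ˢ in over-at v∅ (member (target v v∅))

        lifting :
          ∃[ V ] Σ[ p ∈ V ⟶ U₀ ] IsRegularEpi (𝕊et M core) p ×
          (Σ[ g ∈ pb α p ⟶ pb β p ] π₂ β p ∘ᶠ g ≈ᶠ π₂ α p × Lifts α β p g)
        lifting = V , proj , surjective⇒regularEpi proj surjective , lift , lift-triangle , over

  functions : MaterialCollection M → Functions
  functions coll γ U φ A B hyp =
    let (V , p , epi , g , tri , over) = lifting coll γ U φ ⟪ A ⟫ ⟪ B ⟫ hyp in
    V , p , epi , g , tri , λ v h (t , t₁ , t₂ , h₁ , h₂) →
      over v h (fibre-elim {α = ⟪ A ⟫} {⟪ B ⟫} {p} {v} {g} {h} {t} t₁ t₂ h₁ h₂)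

theorem7p9 : ∀ {ℓ} (M : ∈-Structure ℓ) (core : CoreAxioms M) → MaterialCollection M →
    StructuralCollection (𝕊et M core) (𝕊et-finiteLimits M core)
theorem7p9 M core coll = FibrewiseCollection.structuralCollection
  (𝕊et M core) (𝕊et-finiteLimits M core)
  (collection-of-sets M core coll) (functions M core coll) (equalities M core)
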